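{- Let $n,r,t,c$ be positive integers with $n\ge r\ge 2$ and $t\ge c\ge 1$. Let $a(r,c)=\left(r^r+1-\frac1r\right)(c-1)$. Let $T$ be a tight $r$-tree with $t$ edges and $c(T)\le c$. Then $$\mathrm{ex}_r(n,T)\le\left(\frac{t-1}{r}+a(r,c)\right)\binom{n}{r-1}.$$
   Context: An $r$-graph is a (finite) $r$-uniform hypergraph. An $r$-graph $T$ is a tight $r$-tree if its edges can be ordered as $e_1,\dots,e_t$ so that: (*) for each $i\ge 2$ there are a vertex $v\in e_i$ and an index $1\le s\le i-1$ such that $v\notin\bigcup_{j=1}^{i-1}e_j$ and $e_i\setminus\{v\}\subset e_s$. The vertex set of a tight tree is the union of its edges. Given a tight $r$-tree $T$ and a tight subtree $T'$ of $T$ (a subgraph of $T$ that is itself a tight $r$-tree), $T'$ is a trunk of $T$ if there is an ordering of the edges of $T$ satisfying (*) in which the edges of $T'$ are listed first, and for each $e\in E(T)\setminus E(T')$ there exists $e'\in E(T')$ with $|e\cap e'|=r-1$. $c(T)$ denotes the minimum number of edges in a trunk of $T$. An $r$-graph $G$ contains $H$ if there is an injection $V(H)\to V(G)$ mapping every edge of $H$ to an edge of $G$. $\mathrm{ex}_r(n,H)$ is the largest $m$ such that there exists an $n$-vertex $r$-graph with $m$ edges that does not contain $H$. -}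

module Defs where

open import Data.Fin using (Fin; toℕ; _<_)
open import Data.Fin.Subset using (Subset; ∣_∣; ⁅_⁆; ⋃; _-_; _∩_; _∈_; _∉_; _⊆_)
open import Data.Fin.Subset.Properties using (_∈?_)
open import Data.Integer using (+_)
open import Data.List using (List; []; length; lookup; map; filter; allFin; _++_)
open import Data.List.Membership.Propositional using () renaming (_∈_ to _∈ˡ_; _∉_ to _∉ˡ_)
open import Data.List.Relation.Binary.Permutation.Propositional using (_↭_)
open import Data.List.Relation.Unary.All using (All)
open import Data.List.Relation.Unary.Unique.Propositional using (Unique)
open import Data.Nat using (ℕ; NonZero; _≤_; _∸_; _^_)
open import Data.Product using (Σ; ∃-syntax; _×_)
open import Data.Rational as ℚ using (ℚ; 1ℚ)
open import Function.Definitions using (Injective)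
open import Relation.Binary.PropositionalEquality using (_≡_; _≢_)
open import Relation.Nullary using (¬_)

IsLargest : (ℕ → Set) → ℕ → Set
IsLargest P m = P m × (∀ m′ → P m′ → m′ ≤ m)

IsLeast : (ℕ → Set) → ℕ → Set
IsLeast P m = P m × (∀ m′ → P m′ → m ≤ m′)

-- The vertex set is all of Fin n.  The edge set is a duplicate-free list; the
-- order of the list carries no meaning.
record RGraph (r n : ℕ) : Set where
  field
    edges   : List (Subset n)
    unique  : Unique edges
    uniform : All (λ e → ∣ e ∣ ≡ r) edges

open RGraph public

size : ∀ {r n} → RGraph r n → ℕ
size G = length (edges G)

image : ∀ {k n} → (Fin k → Fin n) → Subset k → Subset n
image {k} f p = ⋃ (map (λ x → ⁅ f x ⁆) (filter (_∈? p) (allFin k)))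

Contains : ∀ {r n k} → RGraph r n → RGraph r k → Set
Contains {n = n} {k = k} G H =
  Σ (Fin k → Fin n) λ f →
    Injective _≡_ _≡_ f × (∀ e → e ∈ˡ edges H → image f e ∈ˡ edges G)

-- IsEx n H m says that ex_r(n,H) = m.
IsEx : ∀ {r k} → ℕ → RGraph r k → ℕ → Set
IsEx {r} n H = IsLargest λ m → Σ (RGraph r n) λ G → size G ≡ m × ¬ Contains G H

-- Positions are counted from 0, so the condition applies to every i except
-- the first position.
IsTightOrdering : ∀ {n} → List (Subset n) → Set
IsTightOrdering es =
  ∀ (i : Fin (length es)) → 1 ≤ toℕ i →
  ∃[ v ] ∃[ s ] v ∈ lookup es i
              × s < i
              × (∀ j → j < i → v ∉ lookup es j)
              × (lookup es i - v) ⊆ lookup es s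

-- This concerns the edge set only.  That the vertex set is the union of the
-- edges is the separate condition Spanned.
IsTightTree : ∀ {r n} → RGraph r n → Set
IsTightTree T =
  edges T ≢ [] × (∃[ es ] es ↭ edges T × IsTightOrdering es)

Spanned : ∀ {r n} → RGraph r n → Set
Spanned {n = n} T = ∀ (v : Fin n) → ∃[ e ] e ∈ˡ edges T × v ∈ e

-- A subtree T′ is given by its edges inside the ambient Fin n; its vertex set
-- is the union of those edges, so T′ need not be Spanned.
record IsTrunk {r n : ℕ} (T T′ : RGraph r n) : Set where
  field
    subgraph : ∀ e → e ∈ˡ edges T′ → e ∈ˡ edges T
    tight    : IsTightTree T′
    prefix   : ∃[ xs ] ∃[ ys ] xs ↭ edges T′
                             × (xs ++ ys) ↭ edges T
                             × IsTightOrdering (xs ++ ys)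
    attached : ∀ e → e ∈ˡ edges T → e ∉ˡ edges T′ →
               ∃[ e′ ] e′ ∈ˡ edges T′ × ∣ e ∩ e′ ∣ ≡ r ∸ 1

-- IsMinTrunkSize T m says that c(T) = m.
IsMinTrunkSize : ∀ {r n} → RGraph r n → ℕ → Set
IsMinTrunkSize {r} {n} T =
  IsLeast λ m → Σ (RGraph r n) λ T′ → IsTrunk T T′ × size T′ ≡ m

fromℕ : ℕ → ℚ
fromℕ m = + m ℚ./ 1

a : (r c : ℕ) .{{_ : NonZero r}} → ℚ
a r c = (fromℕ (r ^ r) ℚ.+ 1ℚ ℚ.- (+ 1 ℚ./ r)) ℚ.* (fromℕ c ℚ.- 1ℚ)

{-# OPTIONS --safe #-}

-- Let T have a trunk with c edges and ℓ = t − c further edges.  Label the vertices of each edge e of G by 0, …, r − 1 so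
-- that the codegrees of the facets e − v_a increase with a.  Call e heavy if r · deg(e − v_a) ≤ (a + 1) ℓ + r (c − 1) for
-- some a.  As the facets of e opposite v_0, …, v_a all have at most this codegree, weighting a facet f by 1/deg(f) shows
-- that there are at most (ℓ + r (c − 1)) / r · C(n, r − 1) heavy edges.  If there are more than
-- (c − 1) r! C(n, r − 1) light edges, then deleting labelled facets that lie in fewer than c light edges leaves a nonempty
-- set of light edges in which the trunk can be embedded greedily, with any prescribed bijection between the colours of T
-- and the labels.  Choose the bijection that orders the colours by the number of leaf edges whose new vertex has that
-- colour: the colours 0, …, a then account for at most (a + 1) ℓ / r leaf edges, so that the leaf edges can be attached
-- greedily in increasing order of colour, by the lower bound on the codegrees in light edges.
module Submission where

open import Defs
open import Data.Nat using (ℕ; NonZero; _≤_; _∸_)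
open import Data.Nat.Combinatorics using (_C_)
open import Data.Integer as ℤ using (+_; 1ℤ)
open import Data.Rational as ℚ using ()
open import Relation.Binary.PropositionalEquality using (_≡_)

import Data.Bool.Properties as Bool
open import Data.Fin as Fin using (Fin; zero; suc; toℕ; fromℕ<; punchIn; punchOut)
open import Data.Fin.Properties as Finₚ
  using (punchIn-punchOut; punchOut-injective; punchIn-injective; punchInᵢ≢i; toℕ-fromℕ<; toℕ-injective; toℕ<n)
open import Data.Fin.Subset using (Subset; inside; outside; ⊥; ⁅_⁆; ⋃; ∣_∣; _-_; _∩_; _⊆_)
  renaming (_∈_ to _∈ˢ_; _∉_ to _∉ˢ_)
open import Data.Fin.Subset.Properties
  using (_∈?_; _⊆?_; ⊆-antisym; p─⊥≡p; p─q⊆p; p⊆q⇒∣p∣≤∣q∣; p⊂q⇒∣p∣<∣q∣; x∈p∧x≢y⇒x∈p-y; x∈p∩q⁻; x∈p∪q⁻; x∈p∪q⁺;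
         ∉⊥; x∈⁅x⁆; x∈⁅y⁆⇒x≡y)
import Data.Integer.Properties as ℤ
open import Data.List using (List; []; _∷_; _++_; [_]; length; map; filter; lookup; concatMap; allFin; tabulate;
                             cartesianProductWith; reverse; _ʳ++_)
open import Data.List.Membership.Propositional using (_∈_; _∉_; find; lose)
open import Data.List.Membership.Propositional.Properties
open import Data.List.Properties using (map-++; map-∘; map-tabulate; length-map; length-++; length-tabulate; length-filter;
                                        filter-none; filter-all; filter-≐; ʳ++-defn)
open import Data.List.Relation.Binary.Permutation.Propositional using (_↭_; ↭-sym; ↭⇒↭ₛ)
open import Data.List.Relation.Binary.Permutation.Propositional.Properties
  using (∈-resp-↭; shift; ↭-length; filter-↭; ↭-empty-inv; ↭-reverse) renaming (map⁺ to ↭-map⁺)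
import Data.List.Relation.Binary.Permutation.Setoid.Properties as ↭ₛ
open import Data.List.Relation.Unary.All as All using ([]; _∷_; all?)
open import Data.List.Relation.Unary.All.Properties using (¬All⇒Any¬)
open import Data.List.Relation.Unary.AllPairs using (AllPairs; []; _∷_)
open import Data.List.Relation.Unary.Any as Any using (here; there; any?)
open import Data.List.Relation.Unary.Any.Properties using (lookup-index; reverse⁺; reverse⁻)
import Data.List.Relation.Unary.Sorted.TotalOrder as Sorted
import Data.List.Relation.Unary.Sorted.TotalOrder.Properties as Sortedₚ
open import Data.List.Relation.Unary.Unique.Propositional using (Unique)
import Data.List.Relation.Unary.Unique.Propositional.Properties as Uniqueₚ
import Data.List.Sort as Sort
open import Data.Nat as ℕ hiding (_≟_; ∣_-_∣)
open import Data.Nat.Combinatorics using (nCk+nC[k+1]≡[n+1]C[k+1]; nC1≡n)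
open import Data.Nat.Divisibility using (divides; m∣m*n; ∣-trans; m≤n⇒m!∣n!)
open import Data.Nat.ListAction using (sum)
open import Data.Nat.ListAction.Properties using (sum-++; sum-↭)
open import Data.Nat.Properties as ℕ hiding (_≟_)
open import Data.Nat.Tactic.RingSolver using (solve-∀)
open import Data.Product using (∃; _×_; _,_; proj₁; proj₂)
open import Data.Product.Properties using (,-injective)
open import Data.Rational using (1ℚ; toℚᵘ)
import Data.Rational.Properties as ℚ
open import Data.Rational.Solver using (module +-*-Solver)
open import Data.Rational.Unnormalised as ℚᵘ using (mkℚᵘ; *≡*; *≤*; _≃_)
import Data.Rational.Unnormalised.Properties as ℚᵘ
open import Data.Sum as Sum using (_⊎_; inj₁; inj₂; [_,_]′)
open import Data.Vec as Vec using (Vec; []; _∷_; here; there)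
open import Data.Vec.Functional using (updateAt)
open import Data.Vec.Functional.Properties using (updateAt-updates; updateAt-minimal)
import Data.Vec.Properties as Vecₚ
open import Function using (_∘_; const)
open import Function.Definitions using (Injective)
open import Level using (0ℓ)
open import Relation.Binary using (DecTotalOrder)
import Relation.Binary.Construct.Flip.EqAndOrd as Flip
import Relation.Binary.Construct.On as On
open import Relation.Binary.Definitions using (DecidableEquality)
open import Relation.Binary.PropositionalEquality hiding ([_])
open import Relation.Nullary using (¬_; yes; no; ¬?; contradiction; _×-dec_)
open import Relation.Nullary.Decidable using (decidable-stable)
open import Relation.Unary using (Decidable)

variable
  A B Key : Set
  n k : ℕ

-- Sums and counts over lists

-- Each entry of `xs` is matched with one occurrence in `ys`, which is then removed. As `xs` has no
-- repetitions, its remaining entries still occur in what is left.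
sum-map-⊆ : (g : A → ℕ) {xs ys : List A} → Unique xs → (∀ {x} → x ∈ xs → x ∈ ys) →
            sum (map g xs) ≤ sum (map g ys)
sum-map-⊆ g []           xs⊆ys = z≤n
sum-map-⊆ g {x ∷ xs} {ys} (x≢ ∷ uxs) xs⊆ys with ∈-∃++ (xs⊆ys (here refl))
... | as , bs , refl = begin
  g x + sum (map g xs)           ≤⟨ +-monoʳ-≤ (g x) (sum-map-⊆ g uxs xs⊆) ⟩
  sum (map g (x ∷ as ++ bs))     ≡⟨ sum-↭ (↭-map⁺ g (shift x as bs)) ⟨
  sum (map g (as ++ [ x ] ++ bs)) ∎
  where
  open ≤-Reasoning
  xs⊆ : ∀ {y} → y ∈ xs → y ∈ as ++ bs
  xs⊆ y∈xs with ∈-resp-↭ (shift x as bs) (xs⊆ys (there y∈xs))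
  ... | here refl = contradiction refl (All.lookup x≢ y∈xs)
  ... | there y∈ = y∈

sum-map-1 : (xs : List A) → sum (map (λ _ → 1) xs) ≡ length xs
sum-map-1 []       = refl
sum-map-1 (x ∷ xs) = cong suc (sum-map-1 xs)

length-⊆ : {xs ys : List A} → Unique xs → (∀ {x} → x ∈ xs → x ∈ ys) → length xs ≤ length ys
length-⊆ {xs = xs} {ys} uxs xs⊆ys =
  subst₂ _≤_ (sum-map-1 xs) (sum-map-1 ys) (sum-map-⊆ (λ _ → 1) uxs xs⊆ys)

pigeonhole-∉ : DecidableEquality A → {xs ys : List A} → Unique xs → length ys < length xs →
               ∃ λ x → x ∈ xs × x ∉ ys
pigeonhole-∉ _≟ᴬ_ {xs} {ys} uxs ys<xs with all? (λ x → any? (x ≟ᴬ_) ys) xs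
... | yes xs⊆ys = contradiction (length-⊆ uxs (All.lookup xs⊆ys)) (<⇒≱ ys<xs)
... | no xs⊈ys  = find (¬All⇒Any¬ (λ x → any? (x ≟ᴬ_) ys) xs xs⊈ys)

sum-map-mono : {f g : A → ℕ} (xs : List A) → (∀ {x} → x ∈ xs → f x ≤ g x) →
               sum (map f xs) ≤ sum (map g xs)
sum-map-mono []       f≤g = z≤n
sum-map-mono (x ∷ xs) f≤g = +-mono-≤ (f≤g (here refl)) (sum-map-mono xs (f≤g ∘ there))

sum-map-const : (c : ℕ) (xs : List A) → sum (map (λ _ → c) xs) ≡ length xs * c
sum-map-const c []       = refl
sum-map-const c (x ∷ xs) = cong (λ s → c + s) (sum-map-const c xs)

sum-map-* : (c : ℕ) (f : A → ℕ) (xs : List A) → sum (map (λ x → c * f x) xs) ≡ c * sum (map f xs)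
sum-map-* c f []       = sym (*-zeroʳ c)
sum-map-* c f (x ∷ xs) =
  trans (cong (λ s → c * f x + s) (sum-map-* c f xs)) (sym (*-distribˡ-+ c (f x) _))

sum-concatMap : (g : B → ℕ) (h : A → List B) (xs : List A) →
                sum (map g (concatMap h xs)) ≡ sum (map (λ x → sum (map g (h x))) xs)
sum-concatMap g h []       = refl
sum-concatMap g h (x ∷ xs) = begin
  sum (map g (h x ++ concatMap h xs))              ≡⟨ cong sum (map-++ g (h x) _) ⟩
  sum (map g (h x) ++ map g (concatMap h xs))      ≡⟨ sum-++ (map g (h x)) _ ⟩
  sum (map g (h x)) + sum (map g (concatMap h xs)) ≡⟨ cong (λ s → sum (map g (h x)) + s) (sum-concatMap g h xs) ⟩
  sum (map g (h x)) + sum (map (λ x → sum (map g (h x))) xs) ∎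
  where open ≡-Reasoning

-- Enumerations sorted by a key

byKey : (A → ℕ) → DecTotalOrder 0ℓ 0ℓ 0ℓ
byKey key = On.decTotalOrder ≤-decTotalOrder key

Unique-resp-↭ : {xs ys : List A} → xs ↭ ys → Unique xs → Unique ys
Unique-resp-↭ {A} xs↭ys = ↭ₛ.Unique-resp-↭ (setoid A) (↭⇒↭ₛ xs↭ys)

lookup-injective : {xs : List A} → Unique xs → Injective _≡_ _≡_ (lookup xs)
lookup-injective (x≢ ∷ uxs) {zero}  {zero}  eq = refl
lookup-injective (x≢ ∷ uxs) {zero}  {suc j} eq = contradiction eq (All.lookup x≢ (∈-lookup j))
lookup-injective (x≢ ∷ uxs) {suc i} {zero}  eq = contradiction (sym eq) (All.lookup x≢ (∈-lookup i))
lookup-injective (x≢ ∷ uxs) {suc i} {suc j} eq = cong suc (lookup-injective uxs eq)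

-- Serves to order the vertices of an edge by facet codegree and the colours by number of leaf
-- edges. With `toℕ` as key it merely lists the vertices of an edge.
record SortedEnumeration (key : A → ℕ) (P : A → Set) (r : ℕ) : Set where
  field
    at         : Fin r → A
    injective  : Injective _≡_ _≡_ at
    sound      : ∀ i → P (at i)
    complete   : ∀ {x} → P x → ∃ λ i → at i ≡ x
    monotone   : ∀ {i j} → toℕ i ≤ toℕ j → key (at i) ≤ key (at j)

sortedEnumeration : (key : A → ℕ) (xs : List A) → Unique xs → ∀ {r} → length xs ≡ r →
                    SortedEnumeration key (_∈ xs) r
sortedEnumeration {A} key xs uxs {r} len =
  helper (sort xs) (sort-↭ xs) (sort-↗ xs) (trans (↭-length (sort-↭ xs)) len)
  where
  open Sort (byKey key)
  IsSorted = Sorted.Sorted (DecTotalOrder.totalOrder (byKey key))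
  helper : (ys : List A) → ys ↭ xs → IsSorted ys → length ys ≡ r → SortedEnumeration key (_∈ xs) r
  helper ys ys↭xs ys↗ refl = record
    { at        = lookup ys
    ; injective = lookup-injective (Unique-resp-↭ (↭-sym ys↭xs) uxs)
    ; sound     = λ i → ∈-resp-↭ ys↭xs (∈-lookup i)
    ; complete  = λ x∈ → let x∈ys = ∈-resp-↭ (↭-sym ys↭xs) x∈ in
                         Any.index x∈ys , sym (lookup-index x∈ys)
    ; monotone  = Sortedₚ.lookup-mono-≤ (DecTotalOrder.totalOrder (byKey key)) ys↗
    }

count : {P : A → Set} → Decidable P → List A → ℕ
count P? xs = length (filter P? xs)

count-∷ : {P : A → Set} (P? : Decidable P) (x : A) (xs : List A) → count P? xs ≤ count P? (x ∷ xs)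
count-∷ P? x xs with P? x
... | yes _ = n≤1+n _
... | no  _ = ≤-refl

count-all : {P : A → Set} (P? : Decidable P) (xs : List A) → (∀ {x} → x ∈ xs → P x) →
            count P? xs ≡ length xs
count-all P? xs all = cong length (filter-all P? (All.tabulate all))

count-⊎ : {P Q R : A → Set} (P? : Decidable P) (Q? : Decidable Q) (R? : Decidable R) →
          (∀ {x} → P x → Q x ⊎ R x) → (∀ {x} → Q x → P x) → (∀ {x} → R x → P x) →
          (∀ {x} → Q x → ¬ R x) → ∀ xs → count P? xs ≡ count Q? xs + count R? xs
count-⊎ P? Q? R? P⇒Q⊎R Q⇒P R⇒P Q⇒¬R = go
  where
  go : ∀ xs → count P? xs ≡ count Q? xs + count R? xs
  go []       = refl
  go (x ∷ xs) with P? x | Q? x | R? x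
  ... | yes _ | yes q | yes r = contradiction r (Q⇒¬R q)
  ... | yes _ | yes _ | no _  = cong suc (go xs)
  ... | yes _ | no _  | yes _ = trans (cong suc (go xs)) (sym (+-suc _ _))
  ... | yes p | no ¬q | no ¬r = contradiction (P⇒Q⊎R p) [ ¬q , ¬r ]′
  ... | no ¬p | yes q | _     = contradiction (Q⇒P q) ¬p
  ... | no ¬p | no _  | yes r = contradiction (R⇒P r) ¬p
  ... | no _  | no _  | no _  = go xs

count-∁ : {P : A → Set} (P? : Decidable P) (xs : List A) →
          length xs ≡ count P? xs + count (¬? ∘ P?) xs
count-∁ P? []       = refl
count-∁ P? (x ∷ xs) with P? x
... | yes _ = cong suc (count-∁ P? xs)
... | no  _ = trans (cong suc (count-∁ P? xs)) (sym (+-suc _ _))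

module PrefixAverage (key : A → ℕ) (xs : List A) where

  below exactly : ℕ → ℕ
  below a   = count (λ x → key x <? a) xs
  exactly a = count (λ x → key x ℕ.≟ a) xs

  below-suc : ∀ a → below (suc a) ≡ below a + exactly a
  below-suc a = count-⊎ (λ x → key x <? suc a) (λ x → key x <? a) (λ x → key x ℕ.≟ a)
    (m≤n⇒m<n∨m≡n ∘ s≤s⁻¹) m<n⇒m<1+n (λ { refl → ≤-refl }) <⇒≢ xs

  below-zero : below 0 ≡ 0
  below-zero = cong length (filter-none (λ x → key x <? 0) {xs} (All.universal (λ _ ()) xs))

  below-≤ : ∀ {b} a → (∀ {i} → i < a → exactly i ≤ b) → below a ≤ a * b
  below-≤ {b} zero    _ = ≤-reflexive below-zero
  below-≤ {b} (suc a) h = begin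
    below (suc a)       ≡⟨ below-suc a ⟩
    below a + exactly a ≤⟨ +-mono-≤ (below-≤ a (h ∘ m<n⇒m<1+n)) (h ≤-refl) ⟩
    a * b + b           ≡⟨ +-comm (a * b) b ⟩
    b + a * b           ∎
    where open ≤-Reasoning

  -- The first `a` of `r` nondecreasing class sizes have at most the average of all. Each of them is
  -- at most the last class size, so appending that class preserves the inequality.
  prefix-average : ∀ r → (∀ {i j} → i ≤ j → j < r → exactly i ≤ exactly j) →
                   ∀ {a} → a ≤ r → r * below a ≤ a * below r
  prefix-average r mono a≤r with m≤n⇒m<n∨m≡n a≤r
  prefix-average r mono {a} a≤r | inj₂ refl = ≤-refl
  prefix-average (suc r) mono {a} _ | inj₁ (s≤s a≤r) = begin
    below a + r * below a     ≤⟨ +-mono-≤ (below-≤ a (λ i<a → mono (≤-trans (<⇒≤ i<a) a≤r) ≤-refl))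
                                          (prefix-average r (λ i≤j j<r → mono i≤j (m<n⇒m<1+n j<r)) a≤r) ⟩
    a * exactly r + a * below r ≡⟨ +-comm (a * exactly r) _ ⟩
    a * below r + a * exactly r ≡⟨ *-distribˡ-+ a (below r) (exactly r) ⟨
    a * (below r + exactly r) ≡⟨ cong (a *_) (below-suc r) ⟨
    a * below (suc r)         ∎
    where open ≤-Reasoning

DenseSublist : {R : A → Key → Set} → (∀ κ → Decidable (λ x → R x κ)) → ℕ → List Key → List A → Set
DenseSublist {R = R} R? m K xs =
  ∃ λ ys → Unique ys × (∀ {y} → y ∈ ys → y ∈ xs) × ∃ (_∈ ys) ×
    (∀ {κ y} → κ ∈ K → y ∈ ys → R y κ → m < count (R? κ) ys)

-- Delete the members of an under-full key class until none is left.
dense-sublist : {R : A → Key → Set} (R? : ∀ κ → Decidable (λ x → R x κ)) (m : ℕ) (K : List Key) (xs : List A) →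
                Unique xs → (∀ {x} → x ∈ xs → ∃ λ κ → κ ∈ K × R x κ) →
                length xs ≤ m * length K ⊎ DenseSublist R? m K xs
dense-sublist {Key = Key} {R = R} R? m K xs uxs keyed = go (length K) K refl xs uxs keyed
  where
  bad? : (xs : List _) → Decidable (λ κ → 0 < count (R? κ) xs × count (R? κ) xs ≤ m)
  bad? xs κ = (0 <? count (R? κ) xs) ×-dec (count (R? κ) xs ≤? m)

  count>0 : ∀ {xs x κ} → x ∈ xs → R x κ → 0 < count (R? κ) xs
  count>0 {κ = κ} x∈ Rxκ = ∈-length (∈-filter⁺ (R? κ) x∈ Rxκ)

  go : ∀ N K → length K ≡ N → (xs : List _) → Unique xs → (∀ {x} → x ∈ xs → ∃ λ κ → κ ∈ K × R x κ) →
       length xs ≤ m * length K ⊎ DenseSublist R? m K xs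
  go N K lenK []          uxs keyed = inj₁ z≤n
  go N K lenK xs@(x ∷ xs′) uxs keyed with any? (bad? xs) K
  ... | no ¬bad = inj₂ (xs , uxs , (λ y∈ → y∈) , (x , here refl) ,
                   λ κ∈ y∈ Ryκ → ≰⇒> (λ c≤m → ¬bad (Any.map (λ { refl → count>0 y∈ Ryκ , c≤m }) κ∈)))
  go zero [] lenK (x ∷ xs′) uxs keyed | yes ()
  go (suc N) K lenK xs@(x ∷ xs′) uxs keyed | yes bad with find bad
  ... | κ , κ∈K , 0<c , c≤m with ∈-∃++ κ∈K
  -- The class of `κ` is deleted in full, so `κ` leaves the key list too. Each deletion of at most
  -- `m` members is thus charged to its own key.
  ... | K₁ , K₂ , refl with go N (K₁ ++ K₂) (suc-injective (trans (sym (↭-length (shift κ K₁ K₂))) lenK))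
                             rest (Uniqueₚ.filter⁺ (¬? ∘ R? κ) uxs) keyed′
    where
    rest = filter (¬? ∘ R? κ) xs
    keyed′ : ∀ {y} → y ∈ rest → ∃ λ κ → κ ∈ K₁ ++ K₂ × R y κ
    keyed′ y∈ with ∈-filter⁻ (¬? ∘ R? κ) {xs = xs} y∈
    ... | y∈xs , ¬Ryκ with keyed y∈xs
    ... | κ′ , κ′∈ , Ryκ′ with ∈-resp-↭ (shift κ K₁ K₂) κ′∈
    ... | here refl = contradiction Ryκ′ ¬Ryκ
    ... | there κ′∈′ = κ′ , κ′∈′ , Ryκ′
  ... | inj₁ le = inj₁ (begin
    length xs                                       ≡⟨ count-∁ (R? κ) xs ⟩
    count (R? κ) xs + count (¬? ∘ R? κ) xs          ≤⟨ +-mono-≤ c≤m le ⟩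
    m + m * length (K₁ ++ K₂)                       ≡⟨ *-suc m _ ⟨
    m * suc (length (K₁ ++ K₂))                     ≡⟨ cong (m *_) (↭-length (shift κ K₁ K₂)) ⟨
    m * length (K₁ ++ κ ∷ K₂)                       ∎)
    where open ≤-Reasoning
  ... | inj₂ (ys , uys , ys⊆ , ne , dense) =
    inj₂ (ys , uys , (λ y∈ → proj₁ (∈-filter⁻ (¬? ∘ R? κ) {xs = xs} (ys⊆ y∈))) , ne , dense′)
    where
    dense′ : ∀ {κ′ y} → κ′ ∈ K₁ ++ κ ∷ K₂ → y ∈ ys → R y κ′ → m < count (R? κ′) ys
    dense′ κ′∈ y∈ Ryκ′ with ∈-resp-↭ (shift κ K₁ K₂) κ′∈
    ... | here refl  = contradiction Ryκ′ (proj₂ (∈-filter⁻ (¬? ∘ R? κ) {xs = xs} (ys⊆ y∈)))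
    ... | there κ′∈′ = dense κ′∈′ y∈ Ryκ′

-- Finite subsets and injective tuples

subsetsOfSize : ∀ n → ℕ → List (Subset n)
subsetsOfSize n       zero    = [ ⊥ ]
subsetsOfSize zero    (suc k) = []
subsetsOfSize (suc n) (suc k) =
  map (inside ∷_) (subsetsOfSize n k) ++ map (outside ∷_) (subsetsOfSize n (suc k))

length-subsetsOfSize : ∀ n k → length (subsetsOfSize n k) ≡ n C k
length-subsetsOfSize n       zero    = refl
length-subsetsOfSize zero    (suc k) = refl
length-subsetsOfSize (suc n) (suc k) = begin
  length (map (inside ∷_) (subsetsOfSize n k) ++ map (outside ∷_) (subsetsOfSize n (suc k)))
    ≡⟨ length-++ (map (inside ∷_) (subsetsOfSize n k)) ⟩
  length (map (inside ∷_) (subsetsOfSize n k)) + length (map (outside ∷_) (subsetsOfSize n (suc k)))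
    ≡⟨ cong₂ _+_ (length-map _ (subsetsOfSize n k)) (length-map _ (subsetsOfSize n (suc k))) ⟩
  length (subsetsOfSize n k) + length (subsetsOfSize n (suc k))
    ≡⟨ cong₂ _+_ (length-subsetsOfSize n k) (length-subsetsOfSize n (suc k)) ⟩
  n C k + n C suc k
    ≡⟨ nCk+nC[k+1]≡[n+1]C[k+1] n k ⟩
  suc n C suc k ∎
  where open ≡-Reasoning

∣p∣≡0⇒p≡⊥ : (p : Subset n) → ∣ p ∣ ≡ 0 → p ≡ ⊥
∣p∣≡0⇒p≡⊥ []            _  = refl
∣p∣≡0⇒p≡⊥ (outside ∷ p) eq = cong (outside ∷_) (∣p∣≡0⇒p≡⊥ p eq)

∈-subsetsOfSize : (p : Subset n) → ∣ p ∣ ≡ k → p ∈ subsetsOfSize n k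
∈-subsetsOfSize {k = zero}  p             eq = here (∣p∣≡0⇒p≡⊥ p eq)
∈-subsetsOfSize {k = suc k} (inside ∷ p)  eq = ∈-++⁺ˡ (∈-map⁺ (inside ∷_) (∈-subsetsOfSize p (suc-injective eq)))
∈-subsetsOfSize {k = suc k} (outside ∷ p) eq = ∈-++⁺ʳ _ (∈-map⁺ (outside ∷_) (∈-subsetsOfSize p eq))

length-cartesianProductWith : (f : A → B → Key) (xs : List A) (ys : List B) →
                              length (cartesianProductWith f xs ys) ≡ length xs * length ys
length-cartesianProductWith f []       ys = refl
length-cartesianProductWith f (x ∷ xs) ys = trans (length-++ (map (f x) ys))
  (cong₂ _+_ (length-map (f x) ys) (length-cartesianProductWith f xs ys))

-- `punchIn x` moves the later entries off `x`, so the first entry is not repeated.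
extendTuple : Fin (suc n) → Vec (Fin n) k → Vec (Fin (suc n)) (suc k)
extendTuple x xs = x ∷ Vec.map (punchIn x) xs

length-allFin : ∀ n → length (allFin n) ≡ n
length-allFin n = length-tabulate {n = n} (λ x → x)

injectiveTuples : ∀ n k → List (Vec (Fin n) k)
injectiveTuples n       zero    = [ [] ]
injectiveTuples zero    (suc k) = []
injectiveTuples (suc n) (suc k) = cartesianProductWith extendTuple (allFin (suc n)) (injectiveTuples n k)

∈-injectiveTuples : (xs : Vec (Fin n) k) → Injective _≡_ _≡_ (Vec.lookup xs) → xs ∈ injectiveTuples n k
∈-injectiveTuples                     []       inj = here refl
∈-injectiveTuples {n = suc n} {suc k} (x ∷ xs) inj =
  subst (_∈ injectiveTuples (suc n) (suc k)) (cong (x ∷_) xs≡) (∈-cartesianProductWith⁺ extendTuple (∈-allFin x) (∈-injectiveTuples ys ys-inj))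
  where
  x≢ : ∀ i → x ≢ Vec.lookup xs i
  x≢ i eq with inj {zero} {suc i} eq
  ... | ()
  ys : Vec (Fin n) k
  ys = Vec.tabulate (λ i → punchOut (x≢ i))
  ys-inj : Injective _≡_ _≡_ (Vec.lookup ys)
  ys-inj {i} {j} eq = Finₚ.suc-injective (inj (punchOut-injective (x≢ i) (x≢ j)
    (trans (sym (Vecₚ.lookup∘tabulate _ i)) (trans eq (Vecₚ.lookup∘tabulate _ j)))))
  xs≡ : Vec.map (punchIn x) ys ≡ xs
  xs≡ = begin
    Vec.map (punchIn x) ys                               ≡⟨ Vecₚ.tabulate-∘ (punchIn x) _ ⟨
    Vec.tabulate (λ i → punchIn x (punchOut (x≢ i)))     ≡⟨ Vecₚ.tabulate-cong (λ i → punchIn-punchOut (x≢ i)) ⟩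
    Vec.tabulate (Vec.lookup xs)                         ≡⟨ Vecₚ.tabulate∘lookup xs ⟩
    xs ∎
    where open ≡-Reasoning

-- The absorption identity, by induction with Pascal's rule. It turns the falling factorial that
-- counts injective tuples into `k !` times a binomial coefficient.
[1+k]*[1+n]C[1+k]≡[1+n]*nCk : ∀ n k → suc k * (suc n C suc k) ≡ suc n * (n C k)
[1+k]*[1+n]C[1+k]≡[1+n]*nCk n zero = trans (+-identityʳ _) (trans (nC1≡n (suc n)) (sym (*-identityʳ _)))
[1+k]*[1+n]C[1+k]≡[1+n]*nCk zero (suc k) = *-zeroʳ k
[1+k]*[1+n]C[1+k]≡[1+n]*nCk (suc n) (suc k) = begin
  (2 + k) * ((2 + n) C (2 + k))
    ≡⟨ cong ((2 + k) *_) (nCk+nC[k+1]≡[n+1]C[k+1] (suc n) (suc k)) ⟨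
  (2 + k) * (suc n C suc k + suc n C (2 + k))
    ≡⟨ regroup k (suc n C suc k) (suc n C (2 + k)) ⟩
  suc n C suc k + suc k * (suc n C suc k) + (2 + k) * (suc n C (2 + k))
    ≡⟨ cong₂ (λ a b → suc n C suc k + a + b) ([1+k]*[1+n]C[1+k]≡[1+n]*nCk n k) ([1+k]*[1+n]C[1+k]≡[1+n]*nCk n (suc k)) ⟩
  suc n C suc k + suc n * (n C k) + suc n * (n C suc k)
    ≡⟨ regroup′ n (suc n C suc k) (n C k) (n C suc k) ⟩
  suc n C suc k + suc n * (n C k + n C suc k)
    ≡⟨ cong (λ a → suc n C suc k + suc n * a) (nCk+nC[k+1]≡[n+1]C[k+1] n k) ⟩
  (2 + n) * (suc n C suc k) ∎
  where
  open ≡-Reasoning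
  regroup : ∀ k a b → (2 + k) * (a + b) ≡ a + suc k * a + (2 + k) * b
  regroup = solve-∀
  regroup′ : ∀ n a b c → a + suc n * b + suc n * c ≡ a + suc n * (b + c)
  regroup′ = solve-∀

length-injectiveTuples : ∀ n k → length (injectiveTuples n k) ≡ k ! * (n C k)
length-injectiveTuples n       zero    = refl
length-injectiveTuples zero    (suc k) = sym (*-zeroʳ (suc k !))
length-injectiveTuples (suc n) (suc k) = begin
  length (injectiveTuples (suc n) (suc k))
    ≡⟨ length-cartesianProductWith extendTuple (allFin (suc n)) (injectiveTuples n k) ⟩
  length (allFin (suc n)) * length (injectiveTuples n k)
    ≡⟨ cong₂ _*_ (length-allFin (suc n)) (length-injectiveTuples n k) ⟩
  suc n * (k ! * (n C k))
    ≡⟨ swap (suc n) (k !) (n C k) ⟩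
  k ! * (suc n * (n C k))
    ≡⟨ cong (k ! *_) ([1+k]*[1+n]C[1+k]≡[1+n]*nCk n k) ⟨
  k ! * (suc k * (suc n C suc k))
    ≡⟨ swap (k !) (suc k) _ ⟩
  suc k * (k ! * (suc n C suc k))
    ≡⟨ *-assoc (suc k) (k !) _ ⟨
  suc k ! * (suc n C suc k) ∎
  where
  open ≡-Reasoning
  swap : ∀ a b c → a * (b * c) ≡ b * (a * c)
  swap = solve-∀

-- For `m = k = r` it replaces the `r !` from the count of labelled facets by the `r ^ r` of the
-- theorem.
k!≤m^k : ∀ {m k} → k ≤ m → k ! ≤ m ^ k
k!≤m^k {m} {zero}  _   = ≤-refl
k!≤m^k {m} {suc k} k<m = *-mono-≤ k<m (k!≤m^k (<⇒≤ k<m))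

∣p-x∣ : {p : Subset n} {x : Fin n} → x ∈ˢ p → suc ∣ p - x ∣ ≡ ∣ p ∣
∣p-x∣ {p = inside  ∷ p} here        = cong (suc ∘ ∣_∣) (p─⊥≡p p)
∣p-x∣ {p = inside  ∷ p} (there x∈p) = cong suc (∣p-x∣ x∈p)
∣p-x∣ {p = outside ∷ p} (there x∈p) = ∣p-x∣ x∈p

x∉p-x : (p : Subset n) (x : Fin n) → x ∉ˢ p - x
x∉p-x (inside  ∷ p) zero    ()
x∉p-x (outside ∷ p) zero    ()
x∉p-x (_ ∷ p)       (suc x) (there x∈) = x∉p-x p x x∈

∈-- : {p : Subset n} {x y : Fin n} → y ∈ˢ p - x → y ∈ˢ p
∈-- {p = p} {x} = p─q⊆p p ⁅ x ⁆

⊈⇒∃ : {p q : Subset n} → ¬ (p ⊆ q) → ∃ λ x → x ∈ˢ p × x ∉ˢ q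
⊈⇒∃ {p = p} {q} p⊈q with Finₚ.any? (λ x → (x ∈? p) ×-dec ¬? (x ∈? q))
... | yes found = found
... | no ¬found = contradiction
        (λ {x} x∈p → decidable-stable (x ∈? q) (λ x∉q → ¬found (x , x∈p , x∉q))) p⊈q

⊆∧∣∣≤⇒≡ : {p q : Subset n} → p ⊆ q → ∣ q ∣ ≤ ∣ p ∣ → p ≡ q
⊆∧∣∣≤⇒≡ {p = p} {q} p⊆q q≤p with q ⊆? p
... | yes q⊆p = ⊆-antisym p⊆q q⊆p
... | no q⊈p  = contradiction (p⊂q⇒∣p∣<∣q∣ (p⊆q , ⊈⇒∃ q⊈p)) (≤⇒≯ q≤p)

elements : Subset n → List (Fin n)
elements []            = []
elements (inside  ∷ p) = zero ∷ map suc (elements p)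
elements (outside ∷ p) = map suc (elements p)

length-elements : (p : Subset n) → length (elements p) ≡ ∣ p ∣
length-elements []            = refl
length-elements (inside  ∷ p) = cong suc (trans (length-map suc (elements p)) (length-elements p))
length-elements (outside ∷ p) = trans (length-map suc (elements p)) (length-elements p)

∈-elements⁺ : {p : Subset n} {x : Fin n} → x ∈ˢ p → x ∈ elements p
∈-elements⁺ {p = inside  ∷ p} here       = here refl
∈-elements⁺ {p = inside  ∷ p} (there x∈) = there (∈-map⁺ suc (∈-elements⁺ x∈))
∈-elements⁺ {p = outside ∷ p} (there x∈) = ∈-map⁺ suc (∈-elements⁺ x∈)

∈-elements⁻ : {p : Subset n} {x : Fin n} → x ∈ elements p → x ∈ˢ p
∈-elements⁻ {p = inside  ∷ p} (here refl) = here
∈-elements⁻ {p = inside  ∷ p} (there x∈) with ∈-map⁻ suc x∈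
... | _ , y∈ , refl = there (∈-elements⁻ y∈)
∈-elements⁻ {p = outside ∷ p} x∈ with ∈-map⁻ suc x∈
... | _ , y∈ , refl = there (∈-elements⁻ y∈)

elements-unique : (p : Subset n) → Unique (elements p)
elements-unique []            = []
elements-unique (inside  ∷ p) =
  All.tabulate (λ x∈ eq → zero∉ (subst (_∈ _) (sym eq) x∈)) ∷ Uniqueₚ.map⁺ Finₚ.suc-injective (elements-unique p)
  where
  zero∉ : zero ∉ map suc (elements p)
  zero∉ 0∈ with ∈-map⁻ suc 0∈
  ... | _ , _ , ()
elements-unique (outside ∷ p) = Uniqueₚ.map⁺ Finₚ.suc-injective (elements-unique p)

-- Heavy and light edges

sum-cartesianProductWith : (g : Key → ℕ) (f : A → B → Key) (xs : List A) (ys : List B) →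
  sum (map g (cartesianProductWith f xs ys)) ≡ sum (map (λ x → sum (map (g ∘ f x) ys)) xs)
sum-cartesianProductWith g f []       ys = refl
sum-cartesianProductWith g f (x ∷ xs) ys = begin
  sum (map g (map (f x) ys ++ rest))             ≡⟨ cong sum (map-++ g (map (f x) ys) rest) ⟩
  sum (map g (map (f x) ys) ++ map g rest)       ≡⟨ sum-++ (map g (map (f x) ys)) _ ⟩
  sum (map g (map (f x) ys)) + sum (map g rest)  ≡⟨ cong₂ _+_ (cong sum (sym (map-∘ ys))) (sum-cartesianProductWith g f xs ys) ⟩
  sum (map (g ∘ f x) ys) + sum (map (λ x → sum (map (g ∘ f x) ys)) xs) ∎
  where
  open ≡-Reasoning
  rest = cartesianProductWith f xs ys

-- The hypothesis is added up over the first `a + 1` terms. The remaining terms only enlarge the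
-- right-hand side.
initial-sum-≤ : ∀ {r} (a : Fin r) (Y : Fin r → ℕ) (X c : ℕ) →
                (∀ b → toℕ b ≤ toℕ a → X ≤ c * Y b) → suc (toℕ a) * X ≤ c * sum (map Y (allFin r))
initial-sum-≤ a Y X c h =
  subst (λ ys → suc (toℕ a) * X ≤ c * sum ys) (sym (map-tabulate (λ x → x) Y)) (go a Y h)
  where
  go : ∀ {r} (a : Fin r) (Y : Fin r → ℕ) →
       (∀ b → toℕ b ≤ toℕ a → X ≤ c * Y b) → suc (toℕ a) * X ≤ c * sum (tabulate Y)
  go {suc r} zero Y h = begin
    X + 0                                 ≡⟨ +-identityʳ X ⟩
    X                                     ≤⟨ h zero z≤n ⟩
    c * Y zero                            ≤⟨ *-monoʳ-≤ c (m≤m+n _ _) ⟩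
    c * (Y zero + sum (tabulate (Y ∘ suc))) ∎
    where open ≤-Reasoning
  go {suc r} (suc a) Y h = begin
    X + suc (toℕ a) * X                           ≤⟨ +-mono-≤ (h zero z≤n) (go a (Y ∘ suc) (λ b → h (suc b) ∘ s≤s)) ⟩
    c * Y zero + c * sum (tabulate (Y ∘ suc))     ≡⟨ *-distribˡ-+ c _ _ ⟨
    c * (Y zero + sum (tabulate (Y ∘ suc)))       ∎
    where open ≤-Reasoning

complementary-divisor : ∀ {n d} → 1 ≤ d → d ≤ n → ∃ λ w → n ! ≡ d * w
complementary-divisor {n} {suc d} _ d≤n with ∣-trans (m∣m*n (d !)) (m≤n⇒m!∣n! d≤n)
... | divides w eq = w , trans eq (*-comm w (suc d))

unique-map-∈ : (f : A → B) {xs : List A} → (∀ {x y} → x ∈ xs → y ∈ xs → f x ≡ f y → x ≡ y) →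
               Unique xs → Unique (map f xs)
unique-map-∈ f inj [] = []
unique-map-∈ f {x ∷ xs} inj (x≢ ∷ uxs) =
  All.tabulate fresh ∷ unique-map-∈ f (λ x∈ y∈ → inj (there x∈) (there y∈)) uxs
  where
  fresh : ∀ {y} → y ∈ map f xs → f x ≢ y
  fresh y∈ eq with ∈-map⁻ f y∈
  ... | z , z∈ , refl = All.lookup x≢ z∈ (inj (here refl) (there z∈) eq)

-- `h` and `l` count the heavy and the light edges among all `m`, `b` is the number of facets, and
-- `p` is `r ^ r`.
combine-counts : ∀ {r m h l M c p b} → m ≡ h + l → r * h ≤ M * b → l ≤ c * (p * b) →
                 r * m ≤ (M + r * (c * p)) * b
combine-counts {r} {m} {h} {l} {M} {c} {p} {b} refl h≤ l≤ = begin
  r * (h + l)                   ≡⟨ *-distribˡ-+ r h l ⟩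
  r * h + r * l                 ≤⟨ +-mono-≤ h≤ (*-monoʳ-≤ r l≤) ⟩
  M * b + r * (c * (p * b))     ≡⟨ regroup r M c p b ⟩
  (M + r * (c * p)) * b         ∎
  where
  open ≤-Reasoning
  regroup : ∀ r M c p b → M * b + r * (c * (p * b)) ≡ (M + r * (c * p)) * b
  regroup = solve-∀

-- Here r = q + 1, the trunk has c′ + 1 edges and the tree has l further edges.
module Host (q l c′ : ℕ) {n m : ℕ} (edge : Fin m → Subset n)
            (edge-injective : Injective _≡_ _≡_ edge) (edge-size : ∀ j → ∣ edge j ∣ ≡ suc q) where

  r : ℕ
  r = suc q

  Adj : Subset n → Fin n → Set
  Adj f w = ∃ λ j → w ∈ˢ edge j × edge j - w ≡ f

  opaque
    Adj? : ∀ f → Decidable (Adj f)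
    Adj? f w = Finₚ.any? (λ j → (w ∈? edge j) ×-dec Vecₚ.≡-dec Bool._≟_ (edge j - w) f)

  -- The codegree of `f`: an edge over `f` is determined by its vertex `w` outside `f`, so counting
  -- these vertices counts the edges.
  deg : Subset n → ℕ
  deg f = count (Adj? f) (allFin n)

  opaque
    enumeration : ∀ j → SortedEnumeration (λ v → deg (edge j - v)) (_∈ˢ edge j) r
    enumeration j = record
      { at        = at
      ; injective = injective
      ; sound     = ∈-elements⁻ ∘ sound
      ; complete  = complete ∘ ∈-elements⁺
      ; monotone  = monotone
      }
      where
      open SortedEnumeration (sortedEnumeration (λ v → deg (edge j - v)) (elements (edge j))
        (elements-unique (edge j)) (trans (length-elements (edge j)) (edge-size j)))

  vert : Fin m → Fin r → Fin n
  vert j = SortedEnumeration.at (enumeration j)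

  facet : Fin m → Fin r → Subset n
  facet j a = edge j - vert j a

  vert∈ : ∀ j a → vert j a ∈ˢ edge j
  vert∈ j = SortedEnumeration.sound (enumeration j)

  vert-injective : ∀ j → Injective _≡_ _≡_ (vert j)
  vert-injective j = SortedEnumeration.injective (enumeration j)

  vert-determines : ∀ {i j} → (∀ a → vert i a ≡ vert j a) → i ≡ j
  vert-determines {i} {j} same = edge-injective (⊆-antisym (sub same) (sub (sym ∘ same)))
    where
    sub : ∀ {i j} → (∀ a → vert i a ≡ vert j a) → edge i ⊆ edge j
    sub {i} {j} same x∈ with SortedEnumeration.complete (enumeration i) x∈
    ... | a , refl = subst (_∈ˢ edge j) (sym (same a)) (vert∈ j a)

  edge≡ : ∀ {i j x} → x ∈ˢ edge i → x ∈ˢ edge j → edge i - x ≡ edge j - x → i ≡ j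
  edge≡ {i} {j} {x} x∈i x∈j eq = edge-injective (⊆-antisym (sub x∈j eq) (sub x∈i (sym eq)))
    where
    sub : ∀ {i j} → x ∈ˢ edge j → edge i - x ≡ edge j - x → edge i ⊆ edge j
    sub {i} {j} x∈j eq {y} y∈ with y Fin.≟ x
    ... | yes refl = x∈j
    ... | no y≢x   = ∈-- (subst (y ∈ˢ_) eq (x∈p∧x≢y⇒x∈p-y y∈ y≢x))

  -- After division by `r`, the first term is the allowance for leaf edges whose new vertex has a
  -- label up to `a`, and `c′` is the allowance for the trunk.
  Heavy : Fin m → Set
  Heavy j = ∃ λ a → r * deg (facet j a) ≤ suc (toℕ a) * l + r * c′

  opaque
    heavy? : Decidable Heavy
    heavy? j = Finₚ.any? (λ a → r * deg (facet j a) ≤? suc (toℕ a) * l + r * c′)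

  1≤deg : ∀ j a → 1 ≤ deg (facet j a)
  1≤deg j a = ∈-length (∈-filter⁺ (Adj? (facet j a)) (∈-allFin (vert j a)) (j , vert∈ j a , refl))

  deg≤n : ∀ f → deg f ≤ n
  deg≤n f = subst (deg f ≤_) (length-allFin n) (length-filter (Adj? f) (allFin n))

  -- The reciprocal of the degree, scaled by n ! to stay in ℕ (0 if the degree is 0).
  weight : Subset n → ℕ
  weight f with 1 ≤? deg f
  ... | yes 1≤d = proj₁ (complementary-divisor 1≤d (deg≤n f))
  ... | no  _   = 0

  deg*weight : ∀ {f} → 1 ≤ deg f → n ! ≡ deg f * weight f
  deg*weight {f} 1≤d with 1 ≤? deg f
  ... | yes 1≤d′ = proj₂ (complementary-divisor 1≤d′ (deg≤n f))
  ... | no  1≰d  = contradiction 1≤d 1≰d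

  deg*weight≤ : ∀ f → deg f * weight f ≤ n !
  deg*weight≤ f with 1 ≤? deg f
  ... | yes 1≤d = ≤-reflexive (sym (proj₂ (complementary-divisor 1≤d (deg≤n f))))
  ... | no  _   = subst (_≤ n !) (sym (*-zeroʳ (deg f))) z≤n

  M : ℕ
  M = l + r * c′

  -- Codegrees increase with the label, so the facets opposite the first `a + 1` vertices all have
  -- codegree at most `(a + 1) M / r`. Their reciprocals sum to at least `r / M`, and `weight` is
  -- the reciprocal times `n !`.
  heavy-weight : ∀ {j} → Heavy j → r * n ! ≤ M * sum (map (λ a → weight (facet j a)) (allFin r))
  heavy-weight {j} (a , small) = *-cancelˡ-≤ (suc (toℕ a)) (begin
    suc (toℕ a) * (r * n !)  ≤⟨ initial-sum-≤ a (λ b → weight (facet j b)) (r * n !) (suc (toℕ a) * M) bound ⟩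
    suc (toℕ a) * M * total  ≡⟨ *-assoc (suc (toℕ a)) M total ⟩
    suc (toℕ a) * (M * total) ∎)
    where
    open ≤-Reasoning
    total = sum (map (λ a → weight (facet j a)) (allFin r))
    bound : ∀ b → toℕ b ≤ toℕ a → r * n ! ≤ suc (toℕ a) * M * weight (facet j b)
    bound b b≤a = begin
      r * n !                                      ≡⟨ cong (r *_) (deg*weight (1≤deg j b)) ⟩
      r * (deg (facet j b) * weight (facet j b))   ≡⟨ *-assoc r (deg (facet j b)) _ ⟨
      r * deg (facet j b) * weight (facet j b)     ≤⟨ *-monoˡ-≤ (weight (facet j b)) (begin
        r * deg (facet j b)                ≤⟨ *-monoʳ-≤ r (SortedEnumeration.monotone (enumeration j) b≤a) ⟩
        r * deg (facet j a)                ≤⟨ small ⟩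
        suc (toℕ a) * l + r * c′           ≤⟨ +-monoʳ-≤ (suc (toℕ a) * l) (m≤m+n (r * c′) (toℕ a * (r * c′))) ⟩
        suc (toℕ a) * l + suc (toℕ a) * (r * c′) ≡⟨ *-distribˡ-+ (suc (toℕ a)) l (r * c′) ⟨
        suc (toℕ a) * M                    ∎) ⟩
      suc (toℕ a) * M * weight (facet j b)         ∎

  incidences : List (Subset n × Fin n)
  incidences = concatMap (λ f → map (f ,_) (filter (Adj? f) (allFin n))) (subsetsOfSize n q)

  incidence : Fin m → Fin r → Subset n × Fin n
  incidence j a = facet j a , vert j a

  facet-size : ∀ j a → ∣ facet j a ∣ ≡ q
  facet-size j a = suc-injective (trans (∣p-x∣ (vert∈ j a)) (edge-size j))

  incidence-∈ : ∀ j a → incidence j a ∈ incidences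
  incidence-∈ j a = ∈-concatMap⁺ (λ f → map (f ,_) (filter (Adj? f) (allFin n)))
    (lose (∈-subsetsOfSize (facet j a) (facet-size j a))
          (∈-map⁺ (facet j a ,_) (∈-filter⁺ (Adj? (facet j a)) (∈-allFin (vert j a)) (j , vert∈ j a , refl))))

  incidence-injective : ∀ {i j a b} → incidence i a ≡ incidence j b → i ≡ j × a ≡ b
  incidence-injective {i} {j} {a} {b} eq with ,-injective eq
  ... | facet≡ , vert≡ with edge≡ (vert∈ i a) (subst (_∈ˢ edge j) (sym vert≡) (vert∈ j b))
                               (trans facet≡ (cong (edge j -_) (sym vert≡)))
  ... | refl = refl , vert-injective i vert≡

  -- Double counting of facet weights: `M` times the weight carried by a heavy edge is at least
  -- `r * n !`, while a `q`-set `f` contributes `deg f * weight f`, at most `n !`.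
  heavy-count : r * count heavy? (allFin m) ≤ M * (n C q)
  heavy-count = *-cancelʳ-≤ _ _ (n !) {{n !≢0}} (begin
    r * length H * n !                       ≡⟨ regroup r (length H) (n !) ⟩
    length H * (r * n !)                     ≡⟨ sum-map-const (r * n !) H ⟨
    sum (map (λ _ → r * n !) H)              ≤⟨ sum-map-mono H (λ j∈ → heavy-weight (proj₂ (∈-filter⁻ heavy? {xs = allFin m} j∈))) ⟩
    sum (map (λ j → M * facetSum j) H)       ≡⟨ sum-map-* M facetSum H ⟩
    M * sum (map facetSum H)                 ≡⟨ cong (M *_) (sum-cartesianProductWith (weight ∘ proj₁) incidence H (allFin r)) ⟨
    M * sum (map (weight ∘ proj₁) (cartesianProductWith incidence H (allFin r)))
      -- An edge is determined by a facet and the vertex opposite it, so the incidences of heavy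
      -- edges are distinct members of `incidences`.
      ≤⟨ *-monoʳ-≤ M (sum-map-⊆ (weight ∘ proj₁)
           (Uniqueₚ.cartesianProductWith⁺ incidence incidence-injective
             (Uniqueₚ.filter⁺ heavy? (Uniqueₚ.allFin⁺ m)) (Uniqueₚ.allFin⁺ r))
           (λ x∈ → let j , a , _ , _ , eq = ∈-cartesianProductWith⁻ incidence H (allFin r) x∈ in
                   subst (_∈ incidences) (sym eq) (incidence-∈ j a))) ⟩
    M * sum (map (weight ∘ proj₁) incidences) ≡⟨ cong (M *_) (sum-concatMap (weight ∘ proj₁) _ S) ⟩
    M * sum (map (λ f → sum (map (weight ∘ proj₁) (map (f ,_) (filter (Adj? f) (allFin n))))) S)
      ≤⟨ *-monoʳ-≤ M (sum-map-mono S (λ {f} _ → begin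
           sum (map (weight ∘ proj₁) (map (f ,_) (filter (Adj? f) (allFin n)))) ≡⟨ cong sum (map-∘ (filter (Adj? f) (allFin n))) ⟨
           sum (map (λ _ → weight f) (filter (Adj? f) (allFin n)))             ≡⟨ sum-map-const (weight f) (filter (Adj? f) (allFin n)) ⟩
           deg f * weight f                                                     ≤⟨ deg*weight≤ f ⟩
           n !                                                                  ∎)) ⟩
    M * sum (map (λ _ → n !) S)              ≡⟨ cong (M *_) (sum-map-const (n !) S) ⟩
    M * (length S * n !)                     ≡⟨ cong (λ s → M * (s * n !)) (length-subsetsOfSize n q) ⟩
    M * ((n C q) * n !)                      ≡⟨ *-assoc M (n C q) (n !) ⟨
    M * (n C q) * n !                        ∎)
    where
    open ≤-Reasoning
    H = filter heavy? (allFin m)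
    S = subsetsOfSize n q
    facetSum : Fin m → ℕ
    facetSum j = sum (map (λ a → weight (facet j a)) (allFin r))
    regroup : ∀ a b c → a * b * c ≡ b * (a * c)
    regroup = solve-∀

  -- Labelled facets and dense sets of light edges

  othersList : Fin m → Fin r → List (Fin n)
  othersList j i = tabulate (vert j ∘ punchIn i)

  others : Fin m → Fin r → Vec (Fin n) q
  others j i = Vec.tabulate (vert j ∘ punchIn i)

  others-≡ : ∀ {j j′ i} → others j i ≡ others j′ i → ∀ {b} → b ≢ i → vert j b ≡ vert j′ b
  others-≡ {j} {j′} {i} eq {b} b≢i = begin
    vert j b                             ≡⟨ cong (vert j) (punchIn-punchOut i≢b) ⟨
    vert j (punchIn i (punchOut i≢b))    ≡⟨ Vecₚ.lookup∘tabulate (vert j ∘ punchIn i) (punchOut i≢b) ⟨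
    Vec.lookup (others j i) (punchOut i≢b)  ≡⟨ cong (λ xs → Vec.lookup xs (punchOut i≢b)) eq ⟩
    Vec.lookup (others j′ i) (punchOut i≢b) ≡⟨ Vecₚ.lookup∘tabulate (vert j′ ∘ punchIn i) (punchOut i≢b) ⟩
    vert j′ (punchIn i (punchOut i≢b))   ≡⟨ cong (vert j′) (punchIn-punchOut i≢b) ⟩
    vert j′ b                            ∎
    where
    open ≡-Reasoning
    i≢b : i ≢ b
    i≢b = b≢i ∘ sym

  -- A key is a labelled facet: the missing label and the other vertices in label order. Labels are
  -- recorded because the trunk is embedded with each colour at a prescribed label.
  Extends : Fin r × Vec (Fin n) q → Fin m → Set
  Extends (i , xs) j = others j i ≡ xs

  opaque
    extends? : ∀ κ → Decidable (Extends κ)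
    extends? (i , xs) j = Vecₚ.≡-dec Fin._≟_ (others j i) xs

  keys : List (Fin r × Vec (Fin n) q)
  keys = cartesianProductWith _,_ (allFin r) (injectiveTuples n q)

  others-∈-keys : ∀ j i → (i , others j i) ∈ keys
  others-∈-keys j i = ∈-cartesianProductWith⁺ _,_ (∈-allFin i) (∈-injectiveTuples (others j i) inj)
    where
    inj : Injective _≡_ _≡_ (Vec.lookup (others j i))
    inj {a} {b} eq = punchIn-injective i a b (vert-injective j (begin
      vert j (punchIn i a)       ≡⟨ Vecₚ.lookup∘tabulate _ a ⟨
      Vec.lookup (others j i) a  ≡⟨ eq ⟩
      Vec.lookup (others j i) b  ≡⟨ Vecₚ.lookup∘tabulate _ b ⟩
      vert j (punchIn i b)       ∎))
      where open ≡-Reasoning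

  length-keys : length keys ≡ r ! * (n C q)
  length-keys = trans (length-cartesianProductWith _,_ (allFin r) (injectiveTuples n q))
    (trans (cong₂ _*_ (length-allFin r) (length-injectiveTuples n q)) (sym (*-assoc r (q !) (n C q))))

  -- The set left by the deletions. `dense` serves to extend the trunk inside `members`; `light`
  -- serves to attach leaf edges, which may be any edges of the host.
  record Core : Set where
    field
      members  : List (Fin m)
      distinct : Unique members
      member   : Fin m
      member∈  : member ∈ members
      light    : ∀ {j} → j ∈ members → ∀ a → suc (toℕ a) * l + r * c′ < r * deg (facet j a)
      dense    : ∀ {j} → j ∈ members → ∀ i → c′ < count (extends? (i , others j i)) members

  few-edges-or-core : r * m ≤ (M + r * (c′ * r ^ r)) * (n C q) ⊎ Core
  few-edges-or-core = Sum.map few core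
    (dense-sublist {R = λ j κ → Extends κ j} extends? c′ keys lights (Uniqueₚ.filter⁺ (¬? ∘ heavy?) (Uniqueₚ.allFin⁺ m))
      (λ {j} _ → (zero , others j zero) , others-∈-keys j zero , refl))
    where
    lights = filter (¬? ∘ heavy?) (allFin m)
    few : length lights ≤ c′ * length keys → r * m ≤ (M + r * (c′ * r ^ r)) * (n C q)
    few lights≤ = combine-counts {r} {M = M} {c′} {r ^ r} (trans (sym (length-allFin m)) (count-∁ heavy? (allFin m))) heavy-count
      (≤-trans lights≤ (*-monoʳ-≤ c′ (≤-trans (≤-reflexive length-keys) (*-monoˡ-≤ (n C q) (k!≤m^k {k = r} ≤-refl)))))
    core : DenseSublist {R = λ j κ → Extends κ j} extends? c′ keys lights → Core
    core (ys , uys , ys⊆ , (y , y∈) , dense) = record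
      { members = ys ; distinct = uys ; member = y ; member∈ = y∈
      ; light = λ j∈ a → ≰⇒> (λ le → proj₂ (∈-filter⁻ (¬? ∘ heavy?) {xs = allFin m} (ys⊆ j∈)) (a , le))
      ; dense = λ {j} j∈ i → dense (others-∈-keys j i) j∈ refl
      }

  others-unique : ∀ j i → Unique (othersList j i)
  others-unique j i = Uniqueₚ.tabulate⁺ (punchIn-injective i _ _ ∘ vert-injective j)

  escape : ∀ {j i} {xs used : List (Fin n)} → Unique xs →
           (∀ {b} → b ≢ i → vert j b ∉ xs) → (∀ {b} → b ≢ i → vert j b ∈ used) →
           length used < length xs + q → ∃ λ w → w ∈ xs × w ∉ used
  escape {j} {i} {xs} {used} uxs others∉ others∈ used< with
    pigeonhole-∉ Fin._≟_ (Uniqueₚ.++⁺ uxs (others-unique j i) disjoint)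
      (subst (length used <_) (sym (trans (length-++ xs) (cong (λ s → length xs + s) (length-tabulate (vert j ∘ punchIn i))))) used<)
    where
    disjoint : ∀ {v} → ¬ (v ∈ xs × v ∈ othersList j i)
    disjoint (v∈xs , v∈) with ∈-tabulate⁻ v∈
    ... | k , refl = others∉ (punchInᵢ≢i i k) v∈xs
  ... | w , w∈ , w∉ with ∈-++⁻ xs w∈
  ...   | inj₁ w∈xs = w , w∈xs , w∉
  ...   | inj₂ w∈others with ∈-tabulate⁻ w∈others
  ...     | k , refl = contradiction (others∈ (punchInᵢ≢i i k)) w∉

  module _ (core : Core) where
    open Core core

    opaque
      extend-in-core : ∀ {j i} {used : List (Fin n)} → j ∈ members → (∀ {b} → b ≢ i → vert j b ∈ used) →
                       length used ≤ q + c′ →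
                       ∃ λ j′ → j′ ∈ members × (∀ {b} → b ≢ i → vert j′ b ≡ vert j b) × vert j′ i ∉ used
      extend-in-core {j} {i} {used} j∈ others∈ used≤
        with escape {xs = map (λ j′ → vert j′ i) same} (unique-map-∈ (λ j′ → vert j′ i) inj (Uniqueₚ.filter⁺ (extends? key) distinct))
               others∉ others∈
               (<-≤-trans (s≤s used≤) (subst₂ _≤_ (cong suc (+-comm c′ q)) (cong (_+ q) (sym (length-map _ same)))
                                         (+-monoˡ-≤ q (dense j∈ i))))
        where
        key : Fin r × Vec (Fin n) q
        key = i , others j i
        same : List (Fin m)
        same = filter (extends? key) members
        agree : ∀ {j′} → j′ ∈ same → ∀ {b} → b ≢ i → vert j′ b ≡ vert j b
        agree j′∈ = others-≡ (proj₂ (∈-filter⁻ (extends? key) {xs = members} j′∈))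
        inj : ∀ {x y} → x ∈ same → y ∈ same → vert x i ≡ vert y i → x ≡ y
        inj {x} {y} x∈ y∈ eq = vert-determines all
          where
          all : ∀ a → vert x a ≡ vert y a
          all a with a Fin.≟ i
          ... | yes refl = eq
          ... | no a≢i   = trans (agree x∈ a≢i) (sym (agree y∈ a≢i))
        others∉ : ∀ {b} → b ≢ i → vert j b ∉ map (λ j′ → vert j′ i) same
        others∉ b≢i v∈ with ∈-map⁻ _ v∈
        ... | j′ , j′∈ , eq = b≢i (vert-injective j′ (trans (agree j′∈ b≢i) eq))
      ... | w , w∈ , w∉ with ∈-map⁻ (λ j′ → vert j′ i) w∈
      ...   | j′ , j′∈ , refl with ∈-filter⁻ (extends? (i , others j i)) {xs = members} j′∈
      ...     | j′∈members , same = j′ , j′∈members , others-≡ same , w∉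

  opaque
    -- The new edge may be any host edge over the facet, and its new vertex may carry another label
    -- in it, so the codegree itself is available.
    extend-outside : ∀ {j i} {used : List (Fin n)} → (∀ {b} → b ≢ i → vert j b ∈ used) →
                     length used < deg (facet j i) + q → ∃ λ w → w ∉ used × Adj (facet j i) w
    extend-outside {j} {i} others∈ used<
      with escape (Uniqueₚ.filter⁺ (Adj? (facet j i)) (Uniqueₚ.allFin⁺ n)) others∉ others∈ used<
      where
      others∉ : ∀ {b} → b ≢ i → vert j b ∉ filter (Adj? (facet j i)) (allFin n)
      others∉ {b} b≢i v∈ with proj₂ (∈-filter⁻ (Adj? (facet j i)) {xs = allFin n} v∈)
      ... | j′ , _ , eq = x∉p-x (edge j′) (vert j b)
                            (subst (vert j b ∈ˢ_) (sym eq) (x∈p∧x≢y⇒x∈p-y (vert∈ j b) (b≢i ∘ vert-injective j)))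
    ... | w , w∈ , w∉ = w , w∉ , proj₂ (∈-filter⁻ (Adj? (facet j i)) {xs = allFin n} w∈)

-- Greedy embedding

_[_≔_] : (Fin k → A) → Fin k → A → Fin k → A
f [ i ≔ v ] = updateAt f i (const v)

≔-hit : (f : Fin k → A) (i : Fin k) {v : A} → (f [ i ≔ v ]) i ≡ v
≔-hit f i = updateAt-updates i f

≔-miss : (f : Fin k → A) {i j : Fin k} {v : A} → j ≢ i → (f [ i ≔ v ]) j ≡ f j
≔-miss f {i} {j} j≢i = updateAt-minimal j i f j≢i

-- A partial embedding is encoded as a total function with irrelevant values off `V`.
InjectiveOn : List A → (A → B) → Set
InjectiveOn V f = ∀ {x y} → x ∈ V → y ∈ V → f x ≡ f y → x ≡ y

injectiveOn-≔ : {V : List (Fin k)} {f : Fin k → A} {v : Fin k} {w : A} → InjectiveOn V f →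
                v ∉ V → w ∉ map f V → InjectiveOn (v ∷ V) (f [ v ≔ w ])
injectiveOn-≔ {V = V} {f} {v} {w} inj v∉ w∉ = go
  where
  miss : ∀ {x} → x ∈ V → (f [ v ≔ w ]) x ≡ f x
  miss x∈ = ≔-miss f (λ { refl → v∉ x∈ })
  clash : ∀ {x} → x ∈ V → w ≢ (f [ v ≔ w ]) x
  clash x∈ eq = w∉ (subst (_∈ _) (sym (trans eq (miss x∈))) (∈-map⁺ f x∈))
  go : InjectiveOn (v ∷ V) (f [ v ≔ w ])
  go (here refl) (here refl) eq = refl
  go (here refl) (there y∈)  eq = contradiction (trans (sym (≔-hit f v)) eq) (clash y∈)
  go (there x∈)  (here refl) eq = contradiction (trans (sym (≔-hit f v)) (sym eq)) (clash x∈)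
  go (there x∈)  (there y∈)  eq = inj x∈ y∈ (trans (sym (miss x∈)) (trans eq (miss y∈)))

-- A tight tree with its proper r-colouring: an edge is the tuple of its vertices indexed by colour.
data Tree {r k : ℕ} : List (Fin r → Fin k) → Set where
  single : ∀ {ρ} → Injective _≡_ _≡_ ρ → Tree [ ρ ]
  grow   : ∀ {ρs ρ v} → Tree ρs → ρ ∈ ρs → (i : Fin r) → (∀ {ρ′} → ρ′ ∈ ρs → ∀ a → ρ′ a ≢ v) →
           Tree (ρ [ i ≔ v ] ∷ ρs)

-- An edge beyond the trunk: the trunk edge `base` with the new vertex `apex` in place of its vertex
-- of colour `pos`.
record Leaf {r k : ℕ} (ρs : List (Fin r → Fin k)) : Set where
  field
    base  : Fin r → Fin k
    base∈ : base ∈ ρs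
    pos   : Fin r
    apex  : Fin k
    fresh : ∀ {ρ} → ρ ∈ ρs → ∀ a → ρ a ≢ apex

  tuple : Fin r → Fin k
  tuple = base [ pos ≔ apex ]

open Leaf

-- `to` sends a colour of the tree to a label of the host edges.
record Relabelling (r : ℕ) : Set where
  field
    to      : Fin r → Fin r
    from    : Fin r → Fin r
    to-from : ∀ b → to (from b) ≡ b
    from-to : ∀ a → from (to a) ≡ a

module Embed (q l c′ : ℕ) {n m : ℕ} (edge : Fin m → Subset n)
             (edge-injective : Injective _≡_ _≡_ edge) (edge-size : ∀ j → ∣ edge j ∣ ≡ suc q)
             (core : Host.Core q l c′ edge edge-injective edge-size)
             (π : Relabelling (suc q)) where

  open Host q l c′ edge edge-injective edge-size
  open Core core
  open Relabelling π

  Aligned : (Fin k → Fin n) → (Fin r → Fin k) → Fin m → Set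
  Aligned φ ρ j = ∀ a → φ (ρ a) ≡ vert j (to a)

  -- Weaker than `Aligned`: the host edge is hit as a set, whatever its labels. This is kept for
  -- leaf edges, to which nothing is attached later.
  Covers : (Fin k → Fin n) → (Fin r → Fin k) → Fin m → Set
  Covers φ ρ j = (∀ a → φ (ρ a) ∈ˢ edge j) × (∀ {x} → x ∈ˢ edge j → ∃ λ a → φ (ρ a) ≡ x)

  to-injective : ∀ {a b} → to a ≡ to b → a ≡ b
  to-injective {a} {b} eq = trans (sym (from-to a)) (trans (cong from eq) (from-to b))

  from-≢ : ∀ {i b} → b ≢ to i → from b ≢ i
  from-≢ {b = b} b≢ eq = b≢ (trans (sym (to-from b)) (cong to eq))

  aligned-from : (φ : Fin k → Fin n) (ρ : Fin r → Fin k) {j : Fin m} → Aligned φ ρ j →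
                 ∀ b → vert j b ≡ φ (ρ (from b))
  aligned-from φ ρ {j} al b = trans (cong (vert j) (sym (to-from b))) (sym (al (from b)))

  aligned⇒covers : (φ : Fin k → Fin n) (ρ : Fin r → Fin k) {j : Fin m} → Aligned φ ρ j → Covers φ ρ j
  aligned⇒covers φ ρ {j} al =
    (λ a → subst (_∈ˢ edge j) (sym (al a)) (vert∈ j (to a))) ,
    (λ x∈ → let b , eq = SortedEnumeration.complete (enumeration j) x∈ in
            from b , trans (sym (aligned-from φ ρ al b)) eq)

  -- `V` lists the vertices embedded so far: `q + 1` for the first edge and one for each further
  -- edge.
  record TrunkEmbedding (ρs : List (Fin r → Fin k)) : Set where
    field
      φ        : Fin k → Fin n
      V        : List (Fin k)
      V-length : length V ≡ q + length ρs
      V-sound  : ∀ {v} → v ∈ V → ∃ λ ρ → ρ ∈ ρs × ∃ λ a → ρ a ≡ v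
      V-all    : ∀ {ρ} → ρ ∈ ρs → ∀ a → ρ a ∈ V
      φ-inj    : InjectiveOn V φ
      aligned  : ∀ {ρ} → ρ ∈ ρs → ∃ λ j → j ∈ members × Aligned φ ρ j

  verts-used : (φ : Fin k → Fin n) (ρ : Fin r → Fin k) {j : Fin m} {V : List (Fin k)} → Aligned φ ρ j →
               (∀ a → ρ a ∈ V) → ∀ b → vert j b ∈ map φ V
  verts-used φ ρ {V = V} al ρ∈V b = subst (_∈ map φ V) (sym (aligned-from φ ρ al b)) (∈-map⁺ φ (ρ∈V (from b)))

  transport : (ρ : Fin r → Fin k) → Fin m → Fin k → Fin n
  transport ρ j u with Finₚ.any? (λ a → ρ a Fin.≟ u)
  ... | yes (a , _) = vert j (to a)
  -- A default value, for vertices that are not embedded yet.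
  ... | no _        = vert j zero

  transport-aligned : {ρ : Fin r → Fin k} → Injective _≡_ _≡_ ρ → ∀ j → Aligned (transport ρ j) ρ j
  transport-aligned {ρ = ρ} inj j a with Finₚ.any? (λ b → ρ b Fin.≟ ρ a)
  ... | yes (b , eq) = cong (vert j ∘ to) (inj eq)
  ... | no ¬∃        = contradiction (a , refl) ¬∃

  embed-single : {ρ : Fin r → Fin k} → Injective _≡_ _≡_ ρ → TrunkEmbedding [ ρ ]
  embed-single {ρ = ρ} ρ-inj = record
    { φ        = transport ρ member
    ; V        = tabulate ρ
    ; V-length = trans (length-tabulate ρ) (sym (+-comm q 1))
    ; V-sound  = λ v∈ → let a , eq = ∈-tabulate⁻ {f = ρ} v∈ in ρ , here refl , a , sym eq
    ; V-all    = λ { (here refl) a → ∈-tabulate⁺ {f = ρ} a }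
    ; φ-inj    = inj
    ; aligned  = λ { (here refl) → member , member∈ , transport-aligned ρ-inj member }
    }
    where
    inj : InjectiveOn (tabulate ρ) (transport ρ member)
    inj x∈ y∈ eq with ∈-tabulate⁻ {f = ρ} x∈ | ∈-tabulate⁻ {f = ρ} y∈
    ... | a , refl | b , refl = cong ρ (to-injective (vert-injective member
      (trans (sym (transport-aligned ρ-inj member a)) (trans eq (transport-aligned ρ-inj member b)))))
  -- At most `q + c′` vertices are in use, as `extend-in-core` requires. The tree vertex of colour
  -- `i` goes to a vertex with label `to i`, so the new edge is again aligned with a member of the
  -- core.
  embed-grow : ∀ {ρs ρ} {v : Fin k} → TrunkEmbedding ρs → length ρs ≤ c′ → ρ ∈ ρs → (i : Fin r) →
               (∀ {ρ′} → ρ′ ∈ ρs → ∀ a → ρ′ a ≢ v) → TrunkEmbedding (ρ [ i ≔ v ] ∷ ρs)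
  embed-grow {ρs = ρs} {ρ} {v} embedding ρs≤ ρ∈ i v-fresh = record
    { φ        = φ′
    ; V        = v ∷ V
    ; V-length = trans (cong suc V-length) (sym (+-suc q (length ρs)))
    ; V-sound  = sound
    ; V-all    = all
    ; φ-inj    = injectiveOn-≔ φ-inj v∉V w∉
    ; aligned  = align
    }
    where
    open TrunkEmbedding embedding
    v∉V : v ∉ V
    v∉V v∈ = let _ , ρ′∈ , a , eq = V-sound v∈ in v-fresh ρ′∈ a eq
    j = proj₁ (aligned ρ∈)
    j-aligned : Aligned φ ρ j
    j-aligned = proj₂ (proj₂ (aligned ρ∈))
    extension : ∃ λ j′ → j′ ∈ members × (∀ {b} → b ≢ to i → vert j′ b ≡ vert j b) × vert j′ (to i) ∉ map φ V
    extension = extend-in-core core (proj₁ (proj₂ (aligned ρ∈))) (λ _ → verts-used φ ρ j-aligned (V-all ρ∈) _)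
      (≤-trans (≤-reflexive (trans (length-map φ V) V-length)) (+-monoʳ-≤ q ρs≤))
    j′ = proj₁ extension
    w∉ = proj₂ (proj₂ (proj₂ extension))
    φ′ = φ [ v ≔ vert j′ (to i) ]
    old : ∀ {ρ′} → ρ′ ∈ ρs → ∀ a → φ′ (ρ′ a) ≡ φ (ρ′ a)
    old ρ′∈ a = ≔-miss φ (v-fresh ρ′∈ a)
    sound : ∀ {u} → u ∈ v ∷ V → ∃ λ ρ′ → ρ′ ∈ ρ [ i ≔ v ] ∷ ρs × ∃ λ a → ρ′ a ≡ u
    sound (here refl) = ρ [ i ≔ v ] , here refl , i , ≔-hit ρ i
    sound (there u∈)  = let ρ′ , ρ′∈ , a , eq = V-sound u∈ in ρ′ , there ρ′∈ , a , eq
    all : ∀ {ρ′} → ρ′ ∈ ρ [ i ≔ v ] ∷ ρs → ∀ a → ρ′ a ∈ v ∷ V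
    all (there ρ′∈) a = there (V-all ρ′∈ a)
    all (here refl) a with a Fin.≟ i
    ... | yes refl = here (≔-hit ρ i)
    ... | no a≢i   = there (subst (_∈ V) (sym (≔-miss ρ a≢i)) (V-all ρ∈ a))
    new : Aligned φ′ (ρ [ i ≔ v ]) j′
    new a with a Fin.≟ i
    ... | yes refl = trans (cong φ′ (≔-hit ρ i)) (≔-hit φ v)
    ... | no a≢i   = begin
      φ′ ((ρ [ i ≔ v ]) a) ≡⟨ cong φ′ (≔-miss ρ a≢i) ⟩
      φ′ (ρ a)             ≡⟨ old ρ∈ a ⟩
      φ (ρ a)              ≡⟨ j-aligned a ⟩
      vert j (to a)        ≡⟨ proj₁ (proj₂ (proj₂ extension)) (a≢i ∘ to-injective) ⟨
      vert j′ (to a)       ∎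
      where open ≡-Reasoning
    align : ∀ {ρ′} → ρ′ ∈ ρ [ i ≔ v ] ∷ ρs → ∃ λ j → j ∈ members × Aligned φ′ ρ′ j
    align (here refl) = j′ , proj₁ (proj₂ extension) , new
    align (there ρ′∈) = let j , j∈ , al = aligned ρ′∈ in j , j∈ , λ a → trans (old ρ′∈ a) (al a)

  embed-trunk : {ρs : List (Fin r → Fin k)} → Tree ρs → length ρs ≤ suc c′ → TrunkEmbedding ρs
  embed-trunk (single ρ-inj)              _         = embed-single ρ-inj
  embed-trunk (grow tree ρ∈ i v-fresh)    (s≤s ρs≤) =
    embed-grow (embed-trunk tree (m≤n⇒m≤1+n ρs≤)) ρs≤ ρ∈ i v-fresh

  -- The colour of the new vertex, expressed as the label assigned to it.
  colour : {ρs : List (Fin r → Fin k)} → Leaf ρs → ℕ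
  colour z = toℕ (to (pos z))

  module Leaves {k : ℕ} {ρs : List (Fin r → Fin k)} (tree : Tree ρs) (ρs≤ : length ρs ≤ suc c′) where

    record LeafEmbedding (zs : List (Leaf ρs)) : Set where
      field
        φ        : Fin k → Fin n
        V        : List (Fin k)
        V-length : length V ≡ q + length ρs + length zs
        V-sound  : ∀ {v} → v ∈ V → (∃ λ ρ → ρ ∈ ρs × ∃ λ a → ρ a ≡ v) ⊎ v ∈ map apex zs
        V-all    : ∀ {ρ} → ρ ∈ ρs → ∀ a → ρ a ∈ V
        V-leaf   : ∀ {z} → z ∈ zs → apex z ∈ V
        φ-inj    : InjectiveOn V φ
        aligned  : ∀ {ρ} → ρ ∈ ρs → ∃ λ j → j ∈ members × Aligned φ ρ j
        covers   : ∀ {z} → z ∈ zs → ∃ (Covers φ (tuple z))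

    -- Here `s` leaf edges are in place and `d` is the codegree at label `a`. The hypotheses give
    -- `s + 1 + c′ < d`, and the trunk has at most `q + c′ + 1` vertices; the conclusion is the room
    -- that `extend-outside` needs.
    degree-arith : ∀ {a d s} → r * suc s ≤ suc a * l → suc a * l + r * c′ < r * d →
                   q + length ρs + s < d + q
    degree-arith {a} {d} {s} few lower = begin-strict
      q + length ρs + s    ≤⟨ +-monoˡ-≤ s (+-monoʳ-≤ q ρs≤) ⟩
      q + suc c′ + s       ≡⟨ regroup q c′ s ⟩
      suc s + c′ + q       <⟨ +-monoˡ-< q (*-cancelˡ-< r (suc s + c′) d (begin-strict
        r * (suc s + c′)     ≡⟨ *-distribˡ-+ r (suc s) c′ ⟩
        r * suc s + r * c′   ≤⟨ +-monoˡ-≤ (r * c′) few ⟩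
        suc a * l + r * c′   <⟨ lower ⟩
        r * d                ∎)) ⟩
      d + q                ∎
      where
      open ≤-Reasoning
      regroup : ∀ q c s → q + suc c + s ≡ suc s + c + q
      regroup = solve-∀

    no-leaves : LeafEmbedding []
    no-leaves = record
      { φ = φ ; V = V ; V-length = trans V-length (sym (+-identityʳ _)) ; V-sound = inj₁ ∘ V-sound
      ; V-all = V-all ; V-leaf = λ () ; φ-inj = φ-inj ; aligned = aligned ; covers = λ () }
      where open TrunkEmbedding (embed-trunk tree ρs≤)
    -- The base of `z` is a trunk edge, hence aligned with a light edge, whose facet opposite label
    -- `to (pos z)` has large codegree. The last hypothesis counts `z` as well as the leaves in
    -- place.
    embed-leaf : ∀ {z zs} → LeafEmbedding zs → (∀ {z′} → z′ ∈ zs → apex z ≢ apex z′) →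
                 r * suc (length zs) ≤ suc (colour z) * l → LeafEmbedding (z ∷ zs)
    embed-leaf {z} {zs} embedding z≢ few = record
      { φ        = φ′
      ; V        = apex z ∷ V
      ; V-length = trans (cong suc V-length) (sym (+-suc (q + length ρs) (length zs)))
      ; V-sound  = λ { (here refl) → inj₂ (here refl) ; (there v∈) → Sum.map₂ there (V-sound v∈) }
      ; V-all    = λ ρ∈ a → there (V-all ρ∈ a)
      ; V-leaf   = λ { (here refl) → here refl ; (there z′∈) → there (V-leaf z′∈) }
      ; φ-inj    = injectiveOn-≔ φ-inj z∉V w∉
      ; aligned  = λ ρ∈ → let j , j∈ , al = aligned ρ∈ in j , j∈ , λ a → trans (old (V-all ρ∈ a)) (al a)
      ; covers   = λ { (here refl) → j′ , new-sound , new-complete ; (there z′∈) → preserved z′∈ }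
      }
      where
      open LeafEmbedding embedding
      z∉V : apex z ∉ V
      z∉V z∈ with V-sound z∈
      ... | inj₁ (ρ , ρ∈ , a , eq) = fresh z ρ∈ a eq
      ... | inj₂ z∈′ with ∈-map⁻ apex z∈′
      ...   | z′ , z′∈ , eq = z≢ z′∈ eq
      i = pos z
      j = proj₁ (aligned (base∈ z))
      j-aligned : Aligned φ (base z) j
      j-aligned = proj₂ (proj₂ (aligned (base∈ z)))
      extension : ∃ λ w → w ∉ map φ V × Adj (facet j (to i)) w
      extension = extend-outside (λ _ → verts-used φ (base z) j-aligned (V-all (base∈ z)) _)
        (subst (_< deg (facet j (to i)) + q) (sym (trans (length-map φ V) V-length))
          (degree-arith {colour z} few (light (proj₁ (proj₂ (aligned (base∈ z)))) (to i))))
      w = proj₁ extension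
      w∉ = proj₁ (proj₂ extension)
      j′ = proj₁ (proj₂ (proj₂ extension))
      w∈ : w ∈ˢ edge j′
      w∈ = proj₁ (proj₂ (proj₂ (proj₂ extension)))
      j′-w≡ : edge j′ - w ≡ facet j (to i)
      j′-w≡ = proj₂ (proj₂ (proj₂ (proj₂ extension)))
      φ′ = φ [ apex z ≔ w ]
      old : ∀ {u} → u ∈ V → φ′ u ≡ φ u
      old u∈ = ≔-miss φ (λ { refl → z∉V u∈ })
      new-old : ∀ {a} → a ≢ i → φ′ (tuple z a) ≡ vert j (to a)
      new-old {a} a≢i = begin
        φ′ (tuple z a)  ≡⟨ cong φ′ (≔-miss (base z) a≢i) ⟩
        φ′ (base z a)   ≡⟨ old (V-all (base∈ z) a) ⟩
        φ (base z a)    ≡⟨ j-aligned a ⟩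
        vert j (to a)   ∎
        where open ≡-Reasoning
      new-apex : φ′ (tuple z i) ≡ w
      new-apex = trans (cong φ′ (≔-hit (base z) i)) (≔-hit φ (apex z))
      new-sound : ∀ a → φ′ (tuple z a) ∈ˢ edge j′
      new-sound a with a Fin.≟ i
      ... | yes refl = subst (_∈ˢ edge j′) (sym new-apex) w∈
      ... | no a≢i   = ∈-- (subst₂ _∈ˢ_ (sym (new-old a≢i)) (sym j′-w≡)
                              (x∈p∧x≢y⇒x∈p-y (vert∈ j (to a)) (a≢i ∘ to-injective ∘ vert-injective j)))
      new-complete : ∀ {x} → x ∈ˢ edge j′ → ∃ λ a → φ′ (tuple z a) ≡ x
      new-complete {x} x∈ with x Fin.≟ w
      ... | yes refl = i , new-apex
      ... | no x≢w   = from b , trans (new-old (from-≢ b≢)) (trans (cong (vert j) (to-from b)) eq)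
        where
        x∈facet : x ∈ˢ facet j (to i)
        x∈facet = subst (x ∈ˢ_) j′-w≡ (x∈p∧x≢y⇒x∈p-y x∈ x≢w)
        found = SortedEnumeration.complete (enumeration j) (∈-- x∈facet)
        b = proj₁ found
        eq : vert j b ≡ x
        eq = proj₂ found
        b≢ : b ≢ to i
        b≢ b≡ = x∉p-x (edge j) (vert j (to i))
                  (subst (_∈ˢ facet j (to i)) (trans (sym eq) (cong (vert j) b≡)) x∈facet)
      preserved : ∀ {z′} → z′ ∈ zs → ∃ (Covers φ′ (tuple z′))
      preserved {z′} z′∈ = let j , sound , complete = covers z′∈ in
        j , (λ a → subst (_∈ˢ edge j) (sym (same a)) (sound a)) ,
            (λ x∈ → let a , eq = complete x∈ in a , trans (same a) eq)
        where
        same : ∀ a → φ′ (tuple z′ a) ≡ φ (tuple z′ a)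
        same a with a Fin.≟ pos z′
        ... | yes refl = old (subst (_∈ V) (sym (≔-hit (base z′) (pos z′))) (V-leaf z′∈))
        ... | no a≢    = old (subst (_∈ V) (sym (≔-miss (base z′) a≢)) (V-all (base∈ z′) a))

    -- The head is embedded last, so a nonincreasing list is embedded in increasing order of labels.
    -- When `z` is reached, all of `z ∷ zs` has label at most that of `z`, and the last hypothesis
    -- bounds the number of such leaves.
    embed-leaves : (zs : List (Leaf ρs)) → Unique (map apex zs) →
                   AllPairs (λ z z′ → colour z′ ≤ colour z) zs →
                   (∀ {z} → z ∈ zs → r * count (λ z′ → colour z′ <? suc (colour z)) zs ≤ suc (colour z) * l) →
                   LeafEmbedding zs
    embed-leaves [] _ _ _ = no-leaves
    embed-leaves (z ∷ zs) (z≢ ∷ uzs) (z≥ ∷ sorted) few = embed-leaf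
      (embed-leaves zs uzs sorted
        (λ {z′} z′∈ → ≤-trans (*-monoʳ-≤ r (count-∷ (λ z″ → colour z″ <? suc (colour z′)) z zs)) (few (there z′∈))))
      (λ z′∈ → All.lookup z≢ (∈-map⁺ apex z′∈))
      (subst (λ s → r * s ≤ suc (colour z) * l)
        (count-all (λ z′ → colour z′ <? suc (colour z)) (z ∷ zs)
          (λ { (here refl) → ≤-refl ; (there z′∈) → s≤s (All.lookup z≥ z′∈) }))
        (few (here refl)))

-- Extracting coloured tuples from a tight ordering

-- The condition of a tight ordering on an edge preceded by `ps`, in terms of membership instead of
-- positions.
Attached : List (Subset k) → Subset k → Set
Attached ps e = ∃ λ v → v ∈ˢ e × (∃ λ s → s ∈ ps × e - v ⊆ s) × (∀ {p} → p ∈ ps → v ∉ˢ p)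

mid : (ps : List A) (e : A) (qs : List A) → Fin (length (ps ++ e ∷ qs))
mid []       e qs = zero
mid (p ∷ ps) e qs = suc (mid ps e qs)

lookup-mid : (ps : List A) (e : A) (qs : List A) → lookup (ps ++ e ∷ qs) (mid ps e qs) ≡ e
lookup-mid []       e qs = refl
lookup-mid (p ∷ ps) e qs = lookup-mid ps e qs

1≤mid : (ps : List A) (e : A) (qs : List A) {p : A} → p ∈ ps → 1 ≤ toℕ (mid ps e qs)
1≤mid (p ∷ ps) e qs _ = s≤s z≤n

before-mid⇒∈ : (ps : List A) (e : A) (qs : List A) (i : Fin (length (ps ++ e ∷ qs))) → i Fin.< mid ps e qs →
               lookup (ps ++ e ∷ qs) i ∈ ps
before-mid⇒∈ (p ∷ ps) e qs zero    _         = here refl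
before-mid⇒∈ (p ∷ ps) e qs (suc i) (s≤s i<m) = there (before-mid⇒∈ ps e qs i i<m)

∈⇒before-mid : {ps : List A} (e : A) (qs : List A) {p : A} → p ∈ ps →
               ∃ λ i → i Fin.< mid ps e qs × lookup (ps ++ e ∷ qs) i ≡ p
∈⇒before-mid e qs (here refl) = zero , s≤s z≤n , refl
∈⇒before-mid e qs (there p∈)  = let i , i<m , eq = ∈⇒before-mid e qs p∈ in suc i , s≤s i<m , eq

-- Processed edges are kept in reverse, so that `(e ∷ ps) ʳ++ qs` and `ps ʳ++ (e ∷ qs)` agree by
-- computation. The membership `p ∈ ps` ensures that `e` is not in the first position, where the
-- ordering demands nothing.
ordering-attached : {ps : List (Subset k)} {e p : Subset k} {qs : List (Subset k)} →
                    IsTightOrdering (ps ʳ++ (e ∷ qs)) → p ∈ ps → Attached ps e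
ordering-attached {k} {ps} {e} {p} {qs} ordering p∈ =
  let v , s , v∈ , s<m , fresh , ⊆s = ordering′ (mid rs e qs) (1≤mid rs e qs (reverse⁺ p∈)) in
  v , subst (v ∈ˢ_) (lookup-mid rs e qs) v∈ ,
  (lookup (rs ++ e ∷ qs) s , reverse⁻ (before-mid⇒∈ rs e qs s s<m) ,
   λ {x} x∈ → ⊆s (subst (λ y → x ∈ˢ y - v) (sym (lookup-mid rs e qs)) x∈)) ,
  λ p∈ → let i , i<m , eq = ∈⇒before-mid e qs (reverse⁺ p∈) in subst (v ∉ˢ_) eq (fresh i i<m)
  where
  rs : List (Subset k)
  rs = reverse ps
  ordering′ : IsTightOrdering (rs ++ e ∷ qs)
  ordering′ = subst IsTightOrdering (ʳ++-defn ps) ordering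

record Represents {r k : ℕ} (ρ : Fin r → Fin k) (e : Subset k) : Set where
  field
    injective : Injective _≡_ _≡_ ρ
    sound     : ∀ a → ρ a ∈ˢ e
    complete  : ∀ {u} → u ∈ˢ e → ∃ λ a → ρ a ≡ u

open Represents

represent : {r : ℕ} (e : Subset k) → ∣ e ∣ ≡ r → ∃ λ (ρ : Fin r → Fin k) → Represents ρ e
represent e size = S.at , record
  { injective = S.injective ; sound = ∈-elements⁻ ∘ S.sound ; complete = S.complete ∘ ∈-elements⁺ }
  where
  module S = SortedEnumeration (sortedEnumeration toℕ (elements e) (elements-unique e) (trans (length-elements e) size))

-- As the sizes agree, `y - v` is `s` without a single vertex. The new vertex `v` inherits the
-- colour `i` of that vertex, which keeps the colouring proper.
represents-≔ : {r : ℕ} {ρ : Fin r → Fin k} {s y : Subset k} {v : Fin k} → Represents ρ s → ∣ s ∣ ≡ ∣ y ∣ →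
               v ∈ˢ y → v ∉ˢ s → y - v ⊆ s → ∃ λ i → Represents (ρ [ i ≔ v ]) y
represents-≔ {k} {r} {ρ} {s} {y} {v} rep size v∈y v∉s y-v⊆s with ⊈⇒∃ s⊈y-v
  where
  s⊈y-v : ¬ (s ⊆ y - v)
  s⊈y-v s⊆y-v = <⇒≱ (≤-reflexive (trans (∣p-x∣ v∈y) (sym size))) (p⊆q⇒∣p∣≤∣q∣ s⊆y-v)
... | u , u∈s , u∉y-v with complete rep u∈s
...   | i , refl = i , record { injective = inj ; sound = snd ; complete = cmp }
  where
  y-v≡s-u : y - v ≡ s - ρ i
  y-v≡s-u = ⊆∧∣∣≤⇒≡ (λ x∈ → x∈p∧x≢y⇒x∈p-y (y-v⊆s x∈) (λ { refl → u∉y-v x∈ }))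
    (≤-reflexive (suc-injective (trans (∣p-x∣ u∈s) (trans size (sym (∣p-x∣ v∈y))))))
  v≢ : ∀ a → v ≢ ρ a
  v≢ a refl = v∉s (sound rep a)
  inj : Injective _≡_ _≡_ (ρ [ i ≔ v ])
  inj {a} {b} eq with a Fin.≟ i | b Fin.≟ i
  ... | yes refl | yes refl = refl
  ... | yes refl | no b≢i   = contradiction (trans (sym (≔-hit ρ i)) (trans eq (≔-miss ρ b≢i))) (v≢ b)
  ... | no a≢i   | yes refl = contradiction (trans (sym (≔-hit ρ i)) (trans (sym eq) (≔-miss ρ a≢i))) (v≢ a)
  ... | no a≢i   | no b≢i   = injective rep (trans (sym (≔-miss ρ a≢i)) (trans eq (≔-miss ρ b≢i)))
  snd : ∀ a → (ρ [ i ≔ v ]) a ∈ˢ y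
  snd a with a Fin.≟ i
  ... | yes refl = subst (_∈ˢ y) (sym (≔-hit ρ i)) v∈y
  ... | no a≢i   = ∈-- (subst₂ _∈ˢ_ (sym (≔-miss ρ a≢i)) (sym y-v≡s-u)
                         (x∈p∧x≢y⇒x∈p-y (sound rep a) (a≢i ∘ injective rep)))
  cmp : ∀ {x} → x ∈ˢ y → ∃ λ a → (ρ [ i ≔ v ]) a ≡ x
  cmp {x} x∈ with x Fin.≟ v
  ... | yes refl = i , ≔-hit ρ i
  ... | no x≢v with complete rep (y-v⊆s (x∈p∧x≢y⇒x∈p-y x∈ x≢v))
  ...   | a , refl = a , ≔-miss ρ (λ { refl → u∉y-v (x∈p∧x≢y⇒x∈p-y x∈ x≢v) })

record TreeTuples (r : ℕ) (ps : List (Subset k)) : Set where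
  field
    tuples    : List (Fin r → Fin k)
    tree      : Tree tuples
    size-≡    : length tuples ≡ length ps
    tuple-of  : ∀ {p} → p ∈ ps → ∃ λ ρ → ρ ∈ tuples × Represents ρ p
    edge-of   : ∀ {ρ} → ρ ∈ tuples → ∃ λ p → p ∈ ps × Represents ρ p

first-tuple : {r : ℕ} (p : Subset k) → ∣ p ∣ ≡ r → TreeTuples r [ p ]
first-tuple p size = let ρ , rep = represent p size in record
  { tuples = [ ρ ] ; tree = single (injective rep) ; size-≡ = refl
  ; tuple-of = λ { (here refl) → ρ , here refl , rep }
  ; edge-of  = λ { (here refl) → p , here refl , rep }
  }

attach-tuple : {r : ℕ} {ps : List (Subset k)} {y : Subset k} → (∀ {p} → p ∈ ps → ∣ p ∣ ≡ r) → ∣ y ∣ ≡ r →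
               TreeTuples r ps → Attached ps y → TreeTuples r (y ∷ ps)
attach-tuple {r = r} {ps} {y} sizes size T (v , v∈y , (s , s∈ , y-v⊆s) , v-fresh) = record
  { tuples   = ρ [ i ≔ v ] ∷ tuples
  ; tree     = grow tree ρ∈ i apart
  ; size-≡   = cong suc size-≡
  ; tuple-of = λ { (here refl) → ρ [ i ≔ v ] , here refl , new
                 ; (there p∈)  → let ρ′ , ρ′∈ , rep = tuple-of p∈ in ρ′ , there ρ′∈ , rep }
  ; edge-of  = λ { (here refl) → y , here refl , new
                 ; (there ρ∈)  → let p , p∈ , rep = edge-of ρ∈ in p , there p∈ , rep }
  }
  where
  open TreeTuples T
  ρ   = proj₁ (tuple-of s∈)
  ρ∈  = proj₁ (proj₂ (tuple-of s∈))
  step = represents-≔ (proj₂ (proj₂ (tuple-of s∈))) (trans (sizes s∈) (sym size)) v∈y (v-fresh s∈) y-v⊆s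
  i   = proj₁ step
  new : Represents (ρ [ i ≔ v ]) y
  new = proj₂ step
  apart : ∀ {ρ′} → ρ′ ∈ tuples → ∀ a → ρ′ a ≢ v
  apart ρ′∈ a refl = let p , p∈ , rep = edge-of ρ′∈ in v-fresh p∈ (sound rep a)

-- The trunk edges `qs` join the processed edges one by one. The ordering is handed on for the edges
-- `ys` outside the trunk.
trunk-tuples : {r : ℕ} {ps : List (Subset k)} (qs : List (Subset k)) {ys : List (Subset k)} {p : Subset k} → p ∈ ps →
               (∀ {p} → p ∈ ps → ∣ p ∣ ≡ r) → (∀ {q} → q ∈ qs → ∣ q ∣ ≡ r) →
               IsTightOrdering (ps ʳ++ (qs ++ ys)) → TreeTuples r ps →
               TreeTuples r (qs ʳ++ ps) × IsTightOrdering ((qs ʳ++ ps) ʳ++ ys)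
trunk-tuples []       p∈ sizes size ordering T = T , ordering
trunk-tuples (q ∷ qs) p∈ sizes size ordering T =
  trunk-tuples qs (there p∈) (λ { (here refl) → size (here refl) ; (there p∈) → sizes p∈ }) (size ∘ there) ordering
    (attach-tuple sizes (size (here refl)) T (ordering-attached ordering p∈))

record LeafCover {r : ℕ} (ρs : List (Fin r → Fin k)) (ps ys : List (Subset k)) : Set where
  field
    leaves   : List (Leaf ρs)
    size-≡   : length leaves ≡ length ys
    apex-unique : Unique (map Leaf.apex leaves)
    avoids   : ∀ {z p} → z ∈ leaves → p ∈ ps → Leaf.apex z ∉ˢ p
    leaf-of  : ∀ {y} → y ∈ ys → ∃ λ z → z ∈ leaves × Represents (Leaf.tuple z) y

module _ {q : ℕ} {xs : List (Subset k)} (T : TreeTuples (suc q) xs) (xs-size : ∀ {x} → x ∈ xs → ∣ x ∣ ≡ suc q)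
         {x : Subset k} (x∈ : x ∈ xs) where

  open TreeTuples T

  -- The new vertex `v` of `y` lies in no earlier edge, hence outside the trunk edge `s` that meets
  -- `y` in `q` vertices. So `y ∩ s` is `y - v`, and `y` hangs on `s`, whichever earlier edge the
  -- ordering names.
  leaf-cover : ∀ ps ys → (∀ {x} → x ∈ xs → x ∈ ps) → (∀ {y} → y ∈ ys → ∣ y ∣ ≡ suc q) →
               (∀ {y} → y ∈ ys → ∃ λ x → x ∈ xs × ∣ y ∩ x ∣ ≡ q) →
               IsTightOrdering (ps ʳ++ ys) → LeafCover tuples ps ys
  leaf-cover ps []       xs⊆ps size meets ordering = record
    { leaves = [] ; size-≡ = refl ; apex-unique = [] ; avoids = λ () ; leaf-of = λ () }
  leaf-cover ps (y ∷ ys) xs⊆ps size meets ordering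
    with leaf-cover (y ∷ ps) ys (there ∘ xs⊆ps) (size ∘ there) (meets ∘ there) ordering
       | ordering-attached {ps = ps} ordering (xs⊆ps x∈) | meets (here refl)
  ... | rest | v , v∈y , _ , v-fresh | s , s∈ , y∩s≡q with tuple-of s∈
  ...   | ρ , ρ∈ , rep with represents-≔ rep (trans (xs-size s∈) (sym (size (here refl)))) v∈y (v-fresh (xs⊆ps s∈)) y-v⊆s
    where
    y∩s≡y-v : y ∩ s ≡ y - v
    y∩s≡y-v = ⊆∧∣∣≤⇒≡
      (λ u∈ → let u∈y , u∈s = x∈p∩q⁻ y s u∈ in x∈p∧x≢y⇒x∈p-y u∈y (λ { refl → v-fresh (xs⊆ps s∈) u∈s }))
      (≤-reflexive (suc-injective (trans (∣p-x∣ v∈y) (trans (size (here refl)) (cong suc (sym y∩s≡q))))))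
    y-v⊆s : y - v ⊆ s
    y-v⊆s u∈ = proj₂ (x∈p∩q⁻ y s (subst (_ ∈ˢ_) (sym y∩s≡y-v) u∈))
  ...     | i , new = record
    { leaves  = z ∷ leaves
    ; size-≡  = cong suc (LeafCover.size-≡ rest)
    ; apex-unique = All.tabulate distinct ∷ apex-unique
    ; avoids  = λ { (here refl) p∈ → v-fresh p∈ ; (there z∈) p∈ → avoids z∈ (there p∈) }
    ; leaf-of = λ { (here refl) → z , here refl , new
                  ; (there y∈)  → let z′ , z′∈ , rep = leaf-of y∈ in z′ , there z′∈ , rep }
    }
    where
    open LeafCover rest hiding (size-≡)
    z : Leaf tuples
    z = record { base = ρ ; base∈ = ρ∈ ; pos = i ; apex = v
               ; fresh = λ { ρ′∈ a refl → let p , p∈ , rep = edge-of ρ′∈ in v-fresh (xs⊆ps p∈) (sound rep a) } }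
    distinct : ∀ {u} → u ∈ map Leaf.apex leaves → v ≢ u
    distinct u∈ refl with ∈-map⁻ Leaf.apex u∈
    -- A later apex avoids all earlier edges, among them `y`, which contains `v`.
    ... | z′ , z′∈ , refl = avoids z′∈ (here refl) v∈y

-- The bound in ℚ

toℚᵘ-/ : ∀ i d → toℚᵘ (i ℚ./ suc d) ≃ mkℚᵘ i d
toℚᵘ-/ i d = ℚ.toℚᵘ-fromℚᵘ (mkℚᵘ i d)

fromℕ-+ : ∀ m n → fromℕ (m ℕ.+ n) ≡ fromℕ m ℚ.+ fromℕ n
fromℕ-+ m n = ℚ.toℚᵘ-injective (begin
  toℚᵘ (fromℕ (m ℕ.+ n))                ≈⟨ toℚᵘ-/ (+ (m ℕ.+ n)) 0 ⟩
  mkℚᵘ (+ (m ℕ.+ n)) 0                  ≈⟨ *≡* (cong (ℤ._* + 1) (cong₂ ℤ._+_ (sym (ℤ.*-identityʳ (+ m))) (sym (ℤ.*-identityʳ (+ n))))) ⟩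
  mkℚᵘ (+ m) 0 ℚᵘ.+ mkℚᵘ (+ n) 0        ≈⟨ ℚᵘ.+-cong (toℚᵘ-/ (+ m) 0) (toℚᵘ-/ (+ n) 0) ⟨
  toℚᵘ (fromℕ m) ℚᵘ.+ toℚᵘ (fromℕ n)    ≈⟨ ℚ.toℚᵘ-homo-+ (fromℕ m) (fromℕ n) ⟨
  toℚᵘ (fromℕ m ℚ.+ fromℕ n)            ∎)
  where open ℚᵘ.≃-Reasoning

fromℕ-* : ∀ m n → fromℕ (m ℕ.* n) ≡ fromℕ m ℚ.* fromℕ n
fromℕ-* m n = ℚ.toℚᵘ-injective (begin
  toℚᵘ (fromℕ (m ℕ.* n))                ≈⟨ toℚᵘ-/ (+ (m ℕ.* n)) 0 ⟩
  mkℚᵘ (+ (m ℕ.* n)) 0                  ≈⟨ *≡* (cong (ℤ._* + 1) (ℤ.pos-* m n)) ⟩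
  mkℚᵘ (+ m) 0 ℚᵘ.* mkℚᵘ (+ n) 0        ≈⟨ ℚᵘ.*-cong (toℚᵘ-/ (+ m) 0) (toℚᵘ-/ (+ n) 0) ⟨
  toℚᵘ (fromℕ m) ℚᵘ.* toℚᵘ (fromℕ n)    ≈⟨ ℚ.toℚᵘ-homo-* (fromℕ m) (fromℕ n) ⟨
  toℚᵘ (fromℕ m ℚ.* fromℕ n)            ∎)
  where open ℚᵘ.≃-Reasoning

fromℕ-mono : ∀ {m n} → m ℕ.≤ n → fromℕ m ℚ.≤ fromℕ n
fromℕ-mono {m} {n} m≤n = ℚ.toℚᵘ-cancel-≤ (begin
  toℚᵘ (fromℕ m)  ≃⟨ toℚᵘ-/ (+ m) 0 ⟩
  mkℚᵘ (+ m) 0    ≤⟨ *≤* (ℤ.*-monoʳ-≤-nonNeg (+ 1) (ℤ.+≤+ m≤n)) ⟩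
  mkℚᵘ (+ n) 0    ≃⟨ toℚᵘ-/ (+ n) 0 ⟨
  toℚᵘ (fromℕ n)  ∎)
  where open ℚᵘ.≤-Reasoning

/-*-fromℕ : ∀ m q → (+ m ℚ./ suc q) ℚ.* fromℕ (suc q) ≡ fromℕ m
/-*-fromℕ m q = ℚ.toℚᵘ-injective (begin
  toℚᵘ ((+ m ℚ./ suc q) ℚ.* fromℕ (suc q))         ≈⟨ ℚ.toℚᵘ-homo-* (+ m ℚ./ suc q) (fromℕ (suc q)) ⟩
  toℚᵘ (+ m ℚ./ suc q) ℚᵘ.* toℚᵘ (fromℕ (suc q))   ≈⟨ ℚᵘ.*-cong (toℚᵘ-/ (+ m) q) (toℚᵘ-/ (+ suc q) 0) ⟩
  mkℚᵘ (+ m) q ℚᵘ.* mkℚᵘ (+ suc q) 0               ≈⟨ *≡* (trans (ℤ.*-identityʳ (+ m ℤ.* + suc q)) (cong (+ m ℤ.*_) (cong (λ z → + suc z) (sym (ℕ.*-identityʳ q))))) ⟩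
  mkℚᵘ (+ m) 0                                     ≈⟨ toℚᵘ-/ (+ m) 0 ⟨
  toℚᵘ (fromℕ m)                                   ∎)
  where open ℚᵘ.≃-Reasoning

fromℕ-positive : ∀ q → ℚ.Positive (fromℕ (suc q))
fromℕ-positive q = ℚ.normalize-pos (suc q) 1

-- Everything is multiplied by r, which turns the bound into an inequality between natural numbers.
bound-ℚ : ∀ q {t l c c′ ex b} → t ≡ suc c′ ℕ.+ l → suc c′ ℕ.≤ c →
          suc q ℕ.* ex ℕ.≤ (l ℕ.+ suc q ℕ.* c′ ℕ.+ suc q ℕ.* (c′ ℕ.* suc q ℕ.^ suc q)) ℕ.* b →
          fromℕ ex ℚ.≤ ((+ t ℤ.- 1ℤ) ℚ./ suc q ℚ.+ a (suc q) c) ℚ.* fromℕ b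
bound-ℚ q {t} {l} {suc c₁} {c′} {ex} {b} refl (ℕ.s≤s c′≤c₁) h with ℕ.m≤n⇒∃[o]m+o≡n c′≤c₁
... | d , refl = ℚ.*-cancelʳ-≤-pos R {{fromℕ-positive q}} (begin
  fromℕ ex ℚ.* R                      ≡⟨ fromℕ-* ex r ⟨
  fromℕ (ex ℕ.* r)                    ≡⟨ cong fromℕ (ℕ.*-comm ex r) ⟩
  fromℕ (r ℕ.* ex)                    ≤⟨ fromℕ-mono (ℕ.≤-trans h (ℕ.*-monoˡ-≤ b (ℕ.m≤m+n N e))) ⟩
  fromℕ ((N ℕ.+ e) ℕ.* b)             ≡⟨ fromℕ-* (N ℕ.+ e) b ⟩
  fromℕ (N ℕ.+ e) ℚ.* bq              ≡⟨ cong (ℚ._* bq) N+e≡ ⟩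
  (X ℚ.* R ℚ.+ (P ℚ.+ 1ℚ) ℚ.* D ℚ.* R ℚ.- D ℚ.* (iv ℚ.* R)) ℚ.* bq ≡⟨ rearrange X R P iv D bq ⟩
  (X ℚ.+ (P ℚ.+ 1ℚ ℚ.- iv) ℚ.* D) ℚ.* bq ℚ.* R ≡⟨ cong (λ z → (X ℚ.+ (P ℚ.+ 1ℚ ℚ.- iv) ℚ.* z) ℚ.* bq ℚ.* R) D≡ ⟩
  (X ℚ.+ (P ℚ.+ 1ℚ ℚ.- iv) ℚ.* (fromℕ (suc (c′ ℕ.+ d)) ℚ.- 1ℚ)) ℚ.* bq ℚ.* R ∎)
  where
  open ℚ.≤-Reasoning
  open +-*-Solver
  r = suc q
  p = r ℕ.^ r
  -- For fixed `t`, `N` is `r` times the factor of the stated bound at `c = c′ + 1`, and `e` is its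
  -- increase when `c` becomes `c′ + d + 1`.
  N = l ℕ.+ r ℕ.* c′ ℕ.+ r ℕ.* (c′ ℕ.* p)
  e = q ℕ.* d ℕ.+ r ℕ.* (d ℕ.* p)
  R = fromℕ r
  P = fromℕ p
  bq = fromℕ b
  D = fromℕ (c′ ℕ.+ d)
  iv = + 1 ℚ./ r
  X = + (c′ ℕ.+ l) ℚ./ r
  rearrange : ∀ X R P iv D b → (X ℚ.* R ℚ.+ (P ℚ.+ 1ℚ) ℚ.* D ℚ.* R ℚ.- D ℚ.* (iv ℚ.* R)) ℚ.* b ≡
                               (X ℚ.+ (P ℚ.+ 1ℚ ℚ.- iv) ℚ.* D) ℚ.* b ℚ.* R
  rearrange = solve 6 (λ X R P iv D b → (X :* R :+ (P :+ con 1ℚ) :* D :* R :- D :* (iv :* R)) :* b :=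
                               (X :+ (P :+ con 1ℚ :- iv) :* D) :* b :* R) refl
  D≡ : D ≡ fromℕ (suc (c′ ℕ.+ d)) ℚ.- 1ℚ
  D≡ = trans (solve 1 (λ D → D := con 1ℚ :+ D :- con 1ℚ) refl D) (cong (ℚ._- 1ℚ) (sym (fromℕ-+ 1 (c′ ℕ.+ d))))
  -- Adding `c′ + d` to both sides absorbs the subtracted `1 / r` of `a`, so that the identity can
  -- be stated in the natural numbers.
  natural : ∀ l q c′ d p → l ℕ.+ suc q ℕ.* c′ ℕ.+ suc q ℕ.* (c′ ℕ.* p) ℕ.+ (q ℕ.* d ℕ.+ suc q ℕ.* (d ℕ.* p)) ℕ.+ (c′ ℕ.+ d) ≡
                           c′ ℕ.+ l ℕ.+ (p ℕ.+ 1) ℕ.* (c′ ℕ.+ d) ℕ.* suc q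
  natural = solve-∀
  N+e≡ : fromℕ (N ℕ.+ e) ≡ X ℚ.* R ℚ.+ (P ℚ.+ 1ℚ) ℚ.* D ℚ.* R ℚ.- D ℚ.* (iv ℚ.* R)
  N+e≡ = begin-equality
    fromℕ (N ℕ.+ e)                   ≡⟨ solve 2 (λ x y → x := x :+ y :- y :* con 1ℚ) refl (fromℕ (N ℕ.+ e)) D ⟩
    fromℕ (N ℕ.+ e) ℚ.+ D ℚ.- D ℚ.* 1ℚ ≡⟨ cong₂ (λ x y → x ℚ.- D ℚ.* y) total (sym (/-*-fromℕ 1 q)) ⟩
    X ℚ.* R ℚ.+ (P ℚ.+ 1ℚ) ℚ.* D ℚ.* R ℚ.- D ℚ.* (iv ℚ.* R) ∎
    where
    total : fromℕ (N ℕ.+ e) ℚ.+ D ≡ X ℚ.* R ℚ.+ (P ℚ.+ 1ℚ) ℚ.* D ℚ.* R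
    total = begin-equality
      fromℕ (N ℕ.+ e) ℚ.+ D                                     ≡⟨ fromℕ-+ (N ℕ.+ e) (c′ ℕ.+ d) ⟨
      fromℕ (N ℕ.+ e ℕ.+ (c′ ℕ.+ d))                            ≡⟨ cong fromℕ (natural l q c′ d p) ⟩
      fromℕ (c′ ℕ.+ l ℕ.+ (p ℕ.+ 1) ℕ.* (c′ ℕ.+ d) ℕ.* r)       ≡⟨ fromℕ-+ (c′ ℕ.+ l) _ ⟩
      fromℕ (c′ ℕ.+ l) ℚ.+ fromℕ ((p ℕ.+ 1) ℕ.* (c′ ℕ.+ d) ℕ.* r) ≡⟨ cong₂ ℚ._+_ (sym (/-*-fromℕ (c′ ℕ.+ l) q))
        (trans (fromℕ-* ((p ℕ.+ 1) ℕ.* (c′ ℕ.+ d)) r) (cong (ℚ._* R) (trans (fromℕ-* (p ℕ.+ 1) (c′ ℕ.+ d)) (cong (ℚ._* D) (fromℕ-+ p 1))))) ⟩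
      X ℚ.* R ℚ.+ (P ℚ.+ 1ℚ) ℚ.* D ℚ.* R                        ∎

-- Balancing the leaf edges over the labels

module _ {r : ℕ} (pos : A → Fin r) (zs : List A) where

  private
    occurrences : Fin r → ℕ
    occurrences i = count (λ z → pos z Fin.≟ i) zs

    module E = SortedEnumeration (sortedEnumeration occurrences (allFin r) (Uniqueₚ.allFin⁺ r) (length-allFin r))

  -- The label of a colour is its rank by number of occurrences, the rarest colour first.
  balancedRelabelling : Relabelling r
  balancedRelabelling = record
    { to      = λ i → proj₁ (E.complete (∈-allFin i))
    ; from    = E.at
    ; to-from = λ b → E.injective (proj₂ (E.complete (∈-allFin (E.at b))))
    ; from-to = λ i → proj₂ (E.complete (∈-allFin i))
    }

  open Relabelling balancedRelabelling
  open PrefixAverage (λ z → toℕ (to (pos z))) zs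

  -- The classes of the labels have nondecreasing sizes, so `prefix-average` applies.
  balanced : ∀ {a} → a ≤ r → r * count (λ z → toℕ (to (pos z)) <? a) zs ≤ a * length zs
  balanced {a} a≤r = subst (λ s → r * below a ≤ a * s)
    (count-all (λ z → toℕ (to (pos z)) <? r) zs (λ {z} _ → toℕ<n (to (pos z))))
    (prefix-average r monotone a≤r)
    where
    exactly≡ : ∀ {b} (b<r : b < r) → exactly b ≡ occurrences (from (fromℕ< b<r))
    exactly≡ {b} b<r = cong length (filter-≐ (λ z → toℕ (to (pos z)) ℕ.≟ b) (λ z → pos z Fin.≟ from (fromℕ< b<r))
      ( (λ {z} eq → trans (sym (from-to (pos z))) (cong from (toℕ-injective (trans eq (sym (toℕ-fromℕ< b<r))))))
      , (λ {z} eq → trans (cong (toℕ ∘ to) eq) (trans (cong toℕ (to-from (fromℕ< b<r))) (toℕ-fromℕ< b<r)))) zs)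
    monotone : ∀ {i j} → i ≤ j → j < r → exactly i ≤ exactly j
    monotone i≤j j<r = subst₂ _≤_ (sym (exactly≡ (≤-<-trans i≤j j<r))) (sym (exactly≡ j<r))
      (E.monotone (subst₂ _≤_ (sym (toℕ-fromℕ< (≤-<-trans i≤j j<r))) (sym (toℕ-fromℕ< j<r)) i≤j))

-- Images of edges

∈-⋃⁺ : {ps : List (Subset k)} {p : Subset k} {x : Fin k} → p ∈ ps → x ∈ˢ p → x ∈ˢ ⋃ ps
∈-⋃⁺ (here refl) x∈ = x∈p∪q⁺ (inj₁ x∈)
∈-⋃⁺ (there p∈)  x∈ = x∈p∪q⁺ (inj₂ (∈-⋃⁺ p∈ x∈))

∈-⋃⁻ : (ps : List (Subset k)) {x : Fin k} → x ∈ˢ ⋃ ps → ∃ λ p → p ∈ ps × x ∈ˢ p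
∈-⋃⁻ []       x∈ = contradiction x∈ ∉⊥
∈-⋃⁻ (p ∷ ps) x∈ with x∈p∪q⁻ p (⋃ ps) x∈
... | inj₁ x∈p = p , here refl , x∈p
... | inj₂ x∈⋃ = let p′ , p′∈ , x∈p′ = ∈-⋃⁻ ps x∈⋃ in p′ , there p′∈ , x∈p′

∈-image⁺ : (f : Fin k → Fin n) {p : Subset k} {x : Fin k} → x ∈ˢ p → f x ∈ˢ image f p
∈-image⁺ f {p} {x} x∈ =
  ∈-⋃⁺ (∈-map⁺ (λ x → ⁅ f x ⁆) (∈-filter⁺ (_∈? p) (∈-allFin x) x∈)) (x∈⁅x⁆ (f x))

∈-image⁻ : (f : Fin k → Fin n) (p : Subset k) {y : Fin n} → y ∈ˢ image f p → ∃ λ x → x ∈ˢ p × y ≡ f x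
∈-image⁻ {k} f p y∈ with ∈-⋃⁻ (map (λ x → ⁅ f x ⁆) (filter (_∈? p) (allFin k))) y∈
... | _ , s∈ , y∈s with ∈-map⁻ (λ x → ⁅ f x ⁆) s∈
...   | x , x∈ , refl = x , proj₂ (∈-filter⁻ (_∈? p) {xs = allFin k} x∈) , x∈⁅y⁆⇒x≡y (f x) y∈s

unique-++-disjoint : {xs ys : List A} {x : A} → Unique (xs ++ ys) → x ∈ xs → x ∉ ys
unique-++-disjoint {xs = x ∷ xs} (x≢ ∷ _) (here refl) y∈ = All.lookup x≢ (∈-++⁺ʳ xs y∈) refl
unique-++-disjoint               (_ ∷ u)  (there x∈)  y∈ = unique-++-disjoint u x∈ y∈

-- From a trunk and a core to a copy of the tree

record Structure {k : ℕ} (q : ℕ) (T : RGraph (suc q) k) (c′ l : ℕ) : Set where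
  field
    tuples   : List (Fin (suc q) → Fin k)
    tree     : Tree tuples
    trunk≤   : length tuples ≤ suc c′
    leaves   : List (Leaf tuples)
    leaves≡  : length leaves ≡ l
    apex-unique : Unique (map Leaf.apex leaves)
    tuple-of : ∀ {e} → e ∈ edges T → (∃ λ ρ → ρ ∈ tuples × Represents ρ e) ⊎
                                     (∃ λ z → z ∈ leaves × Represents (Leaf.tuple z) e)

trunk-structure : ∀ {k q} (T T′ : RGraph (suc q) k) → IsTrunk T T′ →
                  ∃ λ c′ → ∃ λ l → size T′ ≡ suc c′ × size T ≡ suc c′ + l × Structure q T c′ l
trunk-structure {q = q} T T′ trunk with IsTrunk.prefix trunk
... | [] , ys , xs↭ , _ , _ = contradiction (↭-empty-inv (↭-sym xs↭)) (proj₁ (IsTrunk.tight trunk))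
... | x ∷ xs , ys , xs↭ , all↭ , ordering =
  length xs , length ys , sym (↭-length xs↭) , trans (sym (↭-length all↭)) (length-++ (x ∷ xs)) , record
    { tuples   = TreeTuples.tuples trunkTuples
    ; tree     = TreeTuples.tree trunkTuples
    ; trunk≤   = ≤-reflexive (trans (TreeTuples.size-≡ trunkTuples) (↭-length ps↭))
    ; leaves   = LeafCover.leaves cover
    ; leaves≡  = LeafCover.size-≡ cover
    ; apex-unique = LeafCover.apex-unique cover
    ; tuple-of = tuple-of
    }
  where
  ps = xs ʳ++ [ x ]
  ps↭ : ps ↭ x ∷ xs
  ps↭ = ↭-reverse (x ∷ xs)
  edge-size : ∀ {e} → e ∈ (x ∷ xs) ++ ys → ∣ e ∣ ≡ suc q
  edge-size e∈ = All.lookup (uniform T) (∈-resp-↭ all↭ e∈)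
  built = trunk-tuples xs (here refl) (λ { (here refl) → edge-size (here refl) ; (there ()) })
            (λ q∈ → edge-size (∈-++⁺ˡ {xs = x ∷ xs} (there q∈))) ordering (first-tuple x (edge-size (here refl)))
  trunkTuples = proj₁ built
  meets : ∀ {y} → y ∈ ys → ∃ λ s → s ∈ ps × ∣ y ∩ s ∣ ≡ q
  meets {y} y∈ =
    let s , s∈ , eq = IsTrunk.attached trunk y (∈-resp-↭ all↭ (∈-++⁺ʳ (x ∷ xs) y∈))
                        -- The edges of `T` are listed without repetition, so an edge after the
                        -- prefix is not in `T′`.
                        (λ y∈T′ → unique-++-disjoint (Unique-resp-↭ (↭-sym all↭) (unique T)) (∈-resp-↭ (↭-sym xs↭) y∈T′) y∈)
    in s , ∈-resp-↭ (↭-sym ps↭) (∈-resp-↭ (↭-sym xs↭) s∈) , eq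
  cover = leaf-cover trunkTuples (λ s∈ → edge-size (∈-++⁺ˡ (∈-resp-↭ ps↭ s∈))) (∈-resp-↭ (↭-sym ps↭) (here refl))
            ps ys (λ s∈ → s∈) (λ y∈ → edge-size (∈-++⁺ʳ (x ∷ xs) y∈)) meets (proj₂ built)
  tuple-of : ∀ {e} → e ∈ edges T → _
  tuple-of e∈ with ∈-++⁻ (x ∷ xs) (∈-resp-↭ (↭-sym all↭) e∈)
  ... | inj₁ e∈xs = inj₁ (TreeTuples.tuple-of trunkTuples (∈-resp-↭ (↭-sym ps↭) e∈xs))
  ... | inj₂ e∈ys = inj₂ (LeafCover.leaf-of cover e∈ys)

module _ {q l c′ k n : ℕ} (T : RGraph (suc q) k) (spanned : Spanned T) (S : Structure q T c′ l)
         (G : RGraph (suc q) n) where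

  edge : Fin (size G) → Subset n
  edge = lookup (edges G)

  edge-injective : Injective _≡_ _≡_ edge
  edge-injective = lookup-injective (unique G)

  edge-size : ∀ j → ∣ edge j ∣ ≡ suc q
  edge-size j = All.lookup (uniform G) (∈-lookup j)

  open Structure S

  module _ (core : Host.Core q l c′ edge edge-injective edge-size) (π : Relabelling (suc q)) where

    open Embed q l c′ edge edge-injective edge-size core π
    open Leaves tree trunk≤

    -- By `Spanned` every vertex of `T` lies in `V`, so injectivity on `V` is injectivity. The image
    -- of each edge of `T` is the host edge that it covers.
    embedding⇒contains : ∀ {zs} → zs ↭ leaves → LeafEmbedding zs → Contains G T
    embedding⇒contains {zs} zs↭ embedding = φ , (λ {u} {v} → φ-inj (u∈V u) (u∈V v)) , image∈
      where
      open LeafEmbedding embedding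
      tuple∈V : ∀ {z} → z ∈ zs → ∀ a → Leaf.tuple z a ∈ V
      tuple∈V {z} z∈ a with a Fin.≟ Leaf.pos z
      ... | yes refl = subst (_∈ V) (sym (≔-hit (Leaf.base z) (Leaf.pos z))) (V-leaf z∈)
      ... | no a≢    = subst (_∈ V) (sym (≔-miss (Leaf.base z) a≢)) (V-all (Leaf.base∈ z) a)
      u∈V : ∀ u → u ∈ V
      u∈V u with spanned u
      ... | e , e∈ , u∈e with tuple-of e∈
      ...   | inj₁ (ρ , ρ∈ , rep) = let a , eq = Represents.complete rep u∈e in subst (_∈ V) eq (V-all ρ∈ a)
      ...   | inj₂ (z , z∈ , rep) = let a , eq = Represents.complete rep u∈e in
                                    subst (_∈ V) eq (tuple∈V (∈-resp-↭ (↭-sym zs↭) z∈) a)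
      image≡ : ∀ {ρ e j} → Represents ρ e → Covers φ ρ j → image φ e ≡ edge j
      image≡ {ρ} {e} {j} rep (sound , complete) = ⊆-antisym to-edge from-edge
        where
        to-edge : image φ e ⊆ edge j
        to-edge y∈ with ∈-image⁻ φ e y∈
        ... | u , u∈ , refl = let a , eq = Represents.complete rep u∈ in subst (λ v → φ v ∈ˢ edge j) eq (sound a)
        from-edge : edge j ⊆ image φ e
        from-edge x∈ with complete x∈
        ... | a , refl = ∈-image⁺ φ (Represents.sound rep a)
      image∈ : ∀ e → e ∈ edges T → image φ e ∈ edges G
      image∈ e e∈ with tuple-of e∈
      ... | inj₁ (ρ , ρ∈ , rep) = let j , _ , al = aligned ρ∈ in
        subst (_∈ edges G) (sym (image≡ rep (aligned⇒covers φ ρ al))) (∈-lookup j)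
      ... | inj₂ (z , z∈ , rep) = let j , cov = covers (∈-resp-↭ (↭-sym zs↭) z∈) in
        subst (_∈ edges G) (sym (image≡ rep cov)) (∈-lookup j)

  core⇒contains : Host.Core q l c′ edge edge-injective edge-size → Contains G T
  core⇒contains core = embedding⇒contains core π sorted↭ embedding
    where
    π : Relabelling (suc q)
    π = balancedRelabelling Leaf.pos leaves
    open Embed q l c′ edge edge-injective edge-size core π
    open Relabelling π
    open Leaves tree trunk≤
    -- The order is reversed because `embed-leaves` treats the head of the list last.
    O = Flip.decTotalOrder (byKey (colour {ρs = tuples}))
    open Sort O
    sorted : List (Leaf tuples)
    sorted = sort leaves
    sorted↭ : sorted ↭ leaves
    sorted↭ = sort-↭ leaves
    few : ∀ {z} → z ∈ sorted → suc q * count (λ z′ → colour z′ <? suc (colour z)) sorted ≤ suc (colour z) * l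
    few {z} _ = subst₂ (λ s t → suc q * s ≤ suc (colour z) * t)
      (sym (↭-length (filter-↭ (λ z′ → colour z′ <? suc (colour z)) sorted↭))) leaves≡
      (balanced Leaf.pos leaves (toℕ<n (to (Leaf.pos z))))
    embedding : LeafEmbedding sorted
    embedding = embed-leaves sorted (Unique-resp-↭ (↭-map⁺ Leaf.apex (↭-sym sorted↭)) apex-unique)
      (Sortedₚ.Sorted⇒AllPairs (DecTotalOrder.totalOrder O) (sort-↗ leaves)) few

  edge-bound : ¬ Contains G T →
               suc q * size G ≤ (l + suc q * c′ + suc q * (c′ * suc q ^ suc q)) * (n C q)
  edge-bound free = Sum.[_,_]′ (λ few → few) (λ core → contradiction (core⇒contains core) free)
    (Host.few-edges-or-core q l c′ edge edge-injective edge-size)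

theorem1p3 : (n r t c : ℕ) .{{_ : NonZero r}} →
    r ≤ n → 2 ≤ r → c ≤ t → 1 ≤ c →
    (k : ℕ) (T : RGraph r k) →
    IsTightTree T → Spanned T → size T ≡ t →
    (cT : ℕ) → IsMinTrunkSize T cT → cT ≤ c →
    (ex : ℕ) → IsEx n T ex →
    fromℕ ex ℚ.≤ ((+ t ℤ.- 1ℤ) ℚ./ r ℚ.+ a r c) ℚ.* fromℕ (n C (r ∸ 1))
theorem1p3 n (suc q) t c _ _ _ _ k T _ spanned refl _ ((T′ , trunk , refl) , _) cT≤c _ ((G , refl , free) , _)
  with trunk-structure T T′ trunk
-- `edge-bound` is applied to an extremal `G`, with a trunk of `c′ + 1` edges, at most `c`.
... | c′ , l , cT≡ , t≡ , S =
  bound-ℚ q {l = l} {c′ = c′} {b = n C q} t≡ (subst (_≤ c) cT≡ cT≤c) (edge-bound T spanned S G free)
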